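{- For all integers $n\ge 1$ and $l$ with $1\le l\le n$, $$S_2(n,l)=\sum_{l\le m\le n}\ \sum_{l_1+\cdots+l_n=m-l}\binom{n-1}{m-1}\binom{m-1}{l-1}\frac{n!}{m!}\binom{m-l}{l_1,\ldots,l_n}B_{l_1}^{(l_1)}\cdots B_{l_n}^{(l_n)},$$ where the inner sum is over all $n$-tuples $(l_1,\ldots,l_n)$ of nonnegative integers with $l_1+\cdots+l_n=m-l$.
   Context: For an integer $r\ge 0$, the Bernoulli numbers of order $r$, $B_k^{(r)}$, are defined by $\left(\frac{t}{e^t-1}\right)^r=\sum_{k=0}^{\infty}B_k^{(r)}\frac{t^k}{k!}$ (so $B_0^{(0)}=1$). $S_2(n,l)$ denotes the Stirling numbers of the second kind. $\binom{N}{l_1,\ldots,l_n}=\frac{N!}{l_1!\cdots l_n!}$ is the multinomial coefficient. -}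

module Defs where

open import Algebra.Bundles using (CommutativeRing)
open import Data.Fin.Base using (Fin; zero; suc; toℕ)
open import Data.Integer.Base using (+_; 1ℤ)
open import Data.List.Base as List using (List; []; _∷_; applyUpTo; concatMap; upTo)
open import Data.List.Membership.Propositional using (_∈_; find; lose)
import Data.List.Membership.Propositional.Properties as ∈
open import Data.List.Relation.Binary.Disjoint.Propositional using (Disjoint)
import Data.List.Relation.Unary.All as All
import Data.List.Relation.Unary.All.Properties as All
open import Data.List.Relation.Unary.AllPairs as AllPairs using ([]; _∷_)
import Data.List.Relation.Unary.AllPairs.Properties as AllPairs
open import Data.List.Relation.Unary.Any using (here)
open import Data.List.Relation.Unary.Unique.Propositional using (Unique)
import Data.List.Relation.Unary.Unique.Propositional.Properties as Unique
open import Data.Nat.Base as ℕ using (ℕ; zero; suc; NonZero; _∸_; _!)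
open import Data.Nat.ListAction using (product)
open import Data.Nat.ListAction.Properties using (product≢0)
import Data.Nat.Properties as ℕ
open import Data.Product.Base using (_,_)
open import Data.Rational.Base using (ℚ; 0ℚ; 1ℚ; _+_; _*_; -_; _/_)
import Data.Rational.Properties as ℚ
open import Data.Vec.Base as Vec using (Vec; []; _∷_; lookup; head)
import Data.Vec.Properties as Vec
open import Relation.Binary.PropositionalEquality

open import Algebra.Properties.Semiring.Sum
  (CommutativeRing.semiring ℚ.+-*-commutativeRing)
  using (sum; sum-cong-≗; sum⁺-syntax)

fromℕ : ℕ → ℚ
fromℕ n = + n / 1

infix 8 _!/_!

_!/_! : ℕ → ℕ → ℚ
n !/ m ! = (+ (n !) / (m !)) {{m ℕ.!≢0}}

------------------------------------------------------------------------
-- Finite sums and products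

infixl 10 sumOver

sumOver : ∀ {a} {A : Set a} → List A → (A → ℚ) → ℚ
sumOver xs f = List.foldr _+_ 0ℚ (List.map f xs)

syntax sumOver xs (λ x → e) = ∑[ x ∈ xs ] e

∏ : ∀ {n} → Vec ℚ n → ℚ
∏ = Vec.foldr′ _*_ 1ℚ

infix 9 _⋯_

-- The integers m with a ≤ m ≤ b (none if b < a).
_⋯_ : ℕ → ℕ → List ℕ
a ⋯ b = applyUpTo (a ℕ.+_) (suc b ∸ a)

-- The n-tuples of natural numbers with sum s, each listed once:
-- see ∈-tuples⁺, ∈-tuples⁻ and tuples-unique.
tuples : (n s : ℕ) → List (Vec ℕ n)
tuples zero    zero    = [] ∷ []
tuples zero    (suc s) = []
tuples (suc n) s       =
  concatMap (λ i → List.map (i ∷_) (tuples n (s ∸ i))) (upTo (suc s))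

∈-tuples⁺ : ∀ {n} (v : Vec ℕ n) → v ∈ tuples n (Vec.sum v)
∈-tuples⁺ []      = here refl
∈-tuples⁺ {suc n} (i ∷ v) = ∈.∈-concatMap⁺ _
  (lose (∈.∈-upTo⁺ (ℕ.s≤s (ℕ.m≤m+n i (Vec.sum v))))
        (∈.∈-map⁺ (i ∷_)
          (subst (λ s → v ∈ tuples n s) (sym (ℕ.m+n∸m≡n i (Vec.sum v))) (∈-tuples⁺ v))))

∈-tuples⁻ : ∀ n {s} {v : Vec ℕ n} → v ∈ tuples n s → Vec.sum v ≡ s
∈-tuples⁻ zero    {zero} (here refl) = refl
∈-tuples⁻ (suc n) {s} v∈
  with i , i∈ , iv∈ ← find (∈.∈-concatMap⁻ (λ i → List.map (i ∷_) (tuples n (s ∸ i))) {xs = upTo (suc s)} v∈)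
  with w , w∈ , refl ← ∈.∈-map⁻ (i ∷_) iv∈
  = trans (cong (i ℕ.+_) (∈-tuples⁻ n w∈)) (ℕ.m+[n∸m]≡n (ℕ.≤-pred (∈.∈-upTo⁻ i∈)))

tuples-unique : ∀ n s → Unique (tuples n s)
tuples-unique zero    zero    = All.[] ∷ []
tuples-unique zero    (suc s) = []
tuples-unique (suc n) s = Unique.concat⁺
  (All.map⁺ (All.universal
    (λ i → Unique.map⁺ Vec.∷-injectiveʳ (tuples-unique n (s ∸ i))) (upTo (suc s))))
  (AllPairs.map⁺ (AllPairs.map disjoint (Unique.upTo⁺ (suc s))))
  where
  disjoint : ∀ {i j} → i ≢ j →
             Disjoint (List.map (i ∷_) (tuples n (s ∸ i)))
                      (List.map (j ∷_) (tuples n (s ∸ j)))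
  disjoint {i} {j} i≢j (v∈i , v∈j)
    with _ , _ , v≡i∷ ← ∈.∈-map⁻ (i ∷_) v∈i
    with _ , _ , v≡j∷ ← ∈.∈-map⁻ (j ∷_) v∈j
    = i≢j (Vec.∷-injectiveˡ (trans (sym v≡i∷) v≡j∷))

------------------------------------------------------------------------
-- Combinatorial numbers

S₂ : ℕ → ℕ → ℕ
S₂ zero    zero    = 1
S₂ zero    (suc l) = 0
S₂ (suc n) zero    = 0
S₂ (suc n) (suc l) = suc l ℕ.* S₂ n (suc l) ℕ.+ S₂ n l

multinomial : ∀ {n} → ℕ → Vec ℕ n → ℚ
multinomial N ls = (+ (N !) / product factorials) {{product≢0 factorials≢0}}
  where
  factorials : List ℕ
  factorials = List.map _! (Vec.toList ls)

  factorials≢0 : All.All NonZero factorials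
  factorials≢0 = All.map⁺ (All.universal ℕ._!≢0 (Vec.toList ls))

------------------------------------------------------------------------
-- Formal power series over ℚ, as coefficient sequences

Series : Set
Series = ℕ → ℚ

𝟙 : Series
𝟙 zero    = 1ℚ
𝟙 (suc _) = 0ℚ

𝕥 : Series
𝕥 zero    = 0ℚ
𝕥 (suc k) = 𝟙 k

infixl 7 _⊛_
infixr 8 _^_

_⊛_ : Series → Series → Series
(f ⊛ g) n = ∑[ i ≤ n ] (f (toℕ i) * g (n ∸ toℕ i))

_^_ : Series → ℕ → Series
f ^ zero  = 𝟙
f ^ suc r = f ⊛ (f ^ r)

-- The coefficients of degrees n, …, 0 (in this order) of the reciprocal of
-- a series f with f 0 ≡ 1ℚ.
inversePrefix : Series → (n : ℕ) → Vec ℚ (suc n)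
inversePrefix f zero    = 1ℚ ∷ []
inversePrefix f (suc n) =
  (- (∑[ i ≤ n ] (f (suc (toℕ i)) * lookup (inversePrefix f n) i)))
  ∷ inversePrefix f n

-- Meaningful only when f 0 ≡ 1ℚ; see ⊛-inverseʳ.
inverse : Series → Series
inverse f n = head (inversePrefix f n)

lookup-inversePrefix : ∀ f n (i : Fin (suc n)) →
                       lookup (inversePrefix f n) i ≡ inverse f (n ∸ toℕ i)
lookup-inversePrefix f zero    zero    = refl
lookup-inversePrefix f (suc n) zero    = refl
lookup-inversePrefix f (suc n) (suc i) = lookup-inversePrefix f n i

⊛-inverseʳ : ∀ f → f 0 ≡ 1ℚ → f ⊛ inverse f ≗ 𝟙
⊛-inverseʳ f f₀≡1 zero    = cong (λ x → x * 1ℚ + 0ℚ) f₀≡1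
⊛-inverseʳ f f₀≡1 (suc n) = begin
  f 0 * (- σ) + τ  ≡⟨ cong (λ x → x * (- σ) + τ) f₀≡1 ⟩
  1ℚ * (- σ) + τ   ≡⟨ cong (_+ τ) (ℚ.*-identityˡ (- σ)) ⟩
  - σ + τ          ≡⟨ cong (λ x → - x + τ) σ≡τ ⟩
  - τ + τ          ≡⟨ ℚ.+-inverseˡ τ ⟩
  0ℚ               ∎
  where
  open ≡-Reasoning

  σ τ : ℚ
  σ = ∑[ i ≤ n ] (f (suc (toℕ i)) * lookup (inversePrefix f n) i)
  τ = ∑[ i ≤ n ] (f (suc (toℕ i)) * inverse f (n ∸ toℕ i))

  σ≡τ : σ ≡ τ
  σ≡τ = sum-cong-≗ λ i →
    cong (f (suc (toℕ i)) *_) (lookup-inversePrefix f n i)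

------------------------------------------------------------------------
-- Bernoulli numbers of higher order

eᵗ-1 : Series
eᵗ-1 zero    = 0ℚ
eᵗ-1 (suc k) = (1ℤ / (suc k !)) {{suc k ℕ.!≢0}}

-- The reciprocal of (eᵗ - 1) / t.
t/[eᵗ-1] : Series
t/[eᵗ-1] = inverse (λ k → eᵗ-1 (suc k))

[eᵗ-1]⊛t/[eᵗ-1]≗t : eᵗ-1 ⊛ t/[eᵗ-1] ≗ 𝕥
[eᵗ-1]⊛t/[eᵗ-1]≗t zero    = refl
[eᵗ-1]⊛t/[eᵗ-1]≗t (suc k) = begin
  0ℚ * t/[eᵗ-1] (suc k) + ρ  ≡⟨ cong (_+ ρ) (ℚ.*-zeroˡ (t/[eᵗ-1] (suc k))) ⟩
  0ℚ + ρ                     ≡⟨ ℚ.+-identityˡ ρ ⟩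
  ρ                          ≡⟨ ⊛-inverseʳ (λ i → eᵗ-1 (suc i)) refl k ⟩
  𝟙 k                        ∎
  where
  open ≡-Reasoning

  ρ : ℚ
  ρ = ((λ i → eᵗ-1 (suc i)) ⊛ t/[eᵗ-1]) k

-- bernoulli r k is the k-th Bernoulli number of order r, so that
-- (t / (eᵗ - 1)) ^ r = Σₖ bernoulli r k tᵏ / k!.
bernoulli : (r k : ℕ) → ℚ
bernoulli r k = fromℕ (k !) * (t/[eᵗ-1] ^ r) k

{-# OPTIONS --safe #-}

-- With φ = t / (eᵗ - 1), put G = Σₖ ([tᵏ] φᵏ) uᵏ, whose coefficients are
-- B_k^(k) / k!, and Q = (1 + u) G. The inner sum of the theorem is (m - l)!
-- times a coefficient of Gⁿ, so, up to factorials, the double sum is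
-- [uⁿ⁻ˡ] (1 + u)ⁿ Gⁿ = [uⁿ⁻ˡ] Qⁿ.
--
-- Lagrange inversion would give Q = u / log (1 + u). Without composing series:
-- put E = eᵗ - 1, multiply log (1 + E) = t, truncated, by φᵏ⁺¹ and compare
-- coefficients of tᵏ⁺¹. As E φ = t, this says
-- (log (1 + u) / u) G = Σₖ ([tᵏ] φᵏ⁺¹) uᵏ, and the differential equation of φ
-- gives [tᵏ] φᵏ⁺¹ = (-1)ᵏ.
--
-- Hence Q² = (1 + u) (Q - u Q′), and the recurrence that follows for the
-- coefficients of the powers of Q is, up to factorials, that of the Stirling
-- numbers.
module Submission where

open import Defs
open import Algebra.Bundles using (CommutativeRing)
import Algebra.Solver.Ring
import Algebra.Solver.Ring.AlmostCommutativeRing as ACR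
open import Data.Fin.Base using (Fin; toℕ)
import Data.Fin.Properties as Fin
import Data.Integer.Base as ℤ
import Data.Integer.Properties as ℤ
open import Data.List.Base as List using (List; []; _∷_; _++_; applyUpTo; concatMap; upTo)
import Data.List.Properties as List
import Data.List.Relation.Unary.All as All
import Data.List.Relation.Unary.All.Properties as All
open import Data.Nat.Base as ℕ using (ℕ; zero; suc; _≤_; _<_; _∸_; _!; NonZero; z≤n; s≤s)
open import Data.Nat.Combinatorics using (_C_; k>n⇒nCk≡0; nCk≡n!/k![n-k]!; k![n∸k]!∣n!; nCk≡nC[n∸k]; nCk+nC[k+1]≡[n+1]C[k+1])
open import Data.Nat.DivMod using (m/n*n≡m)
open import Data.Nat.ListAction using (product)
open import Data.Nat.ListAction.Properties using (product≢0)
import Data.Nat.Properties as ℕ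
open import Data.Nat.Tactic.RingSolver using (solve-∀)
open import Data.Product.Base using (_,_)
open import Data.Rational.Base using (ℚ; 0ℚ; 1ℚ; _+_; _*_; -_; _/_; toℚᵘ)
import Data.Rational.Properties as ℚ
import Data.Rational.Solver as ℚ
open import Data.Rational.Unnormalised.Base as ℚᵘ using (mkℚᵘ; *≡*)
import Data.Rational.Unnormalised.Properties as ℚᵘ
open import Data.Vec.Base as Vec using (Vec; []; _∷_; map)
open import Function.Base using (_∘_)
open import Level using (0ℓ)
open import Relation.Binary.Consequences using (dec⇒weaklyDec)
open import Relation.Binary.PropositionalEquality
import Relation.Binary.Reasoning.Setoid as SetoidReasoning
open import Relation.Nullary.Decidable using (Dec; map′)

open import Algebra.Properties.Semiring.Sum
  (CommutativeRing.semiring ℚ.+-*-commutativeRing)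
  using (sum-cong-≗; sum-syntax; sum⁺-syntax; ∑-distrib-+; *-distribˡ-sum; *-distribʳ-sum; sum-replicate-zero)

open ℚ.+-*-Solver using (solve; _:=_; _:+_; _:*_; con; :-_)

-- The ring of formal power series

infixl 6 _⊕_
infix  8 ⊖_

_⊕_ : Series → Series → Series
(f ⊕ g) n = f n + g n

⊖_ : Series → Series
(⊖ f) n = - f n

κ : ℚ → Series
κ c zero    = c
κ c (suc _) = 0ℚ

⊛-cong : ∀ {f f′ g g′} → f ≗ f′ → g ≗ g′ → f ⊛ g ≗ f′ ⊛ g′
⊛-cong f≗f′ g≗g′ n = sum-cong-≗ {suc n} λ i → cong₂ _*_ (f≗f′ (toℕ i)) (g≗g′ (n ∸ toℕ i))

⊛-distribʳ-⊕ : ∀ h f g → (f ⊕ g) ⊛ h ≗ (f ⊛ h) ⊕ (g ⊛ h)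
⊛-distribʳ-⊕ h f g n = trans
  (sum-cong-≗ {suc n} λ i → ℚ.*-distribʳ-+ (h (n ∸ toℕ i)) (f (toℕ i)) (g (toℕ i)))
  (∑-distrib-+ {suc n} (λ i → f (toℕ i) * h (n ∸ toℕ i)) (λ i → g (toℕ i) * h (n ∸ toℕ i)))

⊛-scaleˡ : ∀ c f g n → ((λ k → c * f k) ⊛ g) n ≡ c * (f ⊛ g) n
⊛-scaleˡ c f g n = trans
  (sum-cong-≗ {suc n} λ i → ℚ.*-assoc c (f (toℕ i)) (g (n ∸ toℕ i)))
  (sym (*-distribˡ-sum {suc n} c λ i → f (toℕ i) * g (n ∸ toℕ i)))

⊛-zeroˡ : ∀ f n → ((λ _ → 0ℚ) ⊛ f) n ≡ 0ℚ
⊛-zeroˡ f zero    = cong (_+ 0ℚ) (ℚ.*-zeroˡ (f 0))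
⊛-zeroˡ f (suc n) = cong₂ _+_ (ℚ.*-zeroˡ (f (suc n))) (⊛-zeroˡ f n)

κ-⊛ : ∀ c f n → (κ c ⊛ f) n ≡ c * f n
κ-⊛ c f zero    = ℚ.+-identityʳ (c * f 0)
κ-⊛ c f (suc n) = trans (cong (c * f (suc n) +_) (⊛-zeroˡ f n)) (ℚ.+-identityʳ (c * f (suc n)))

-- A product unfolds by itself at the lowest coefficient of `f`. This is the unfolding at the lowest
-- coefficient of `g`; matching the two gives `⊛-comm`.
⊛-sucʳ : ∀ f g n → (f ⊛ g) (suc n) ≡ (f ⊛ (g ∘ suc)) n + f (suc n) * g 0
⊛-sucʳ f g zero    =
  solve 2 (λ a b → a :+ (b :+ con 0ℚ) := (a :+ con 0ℚ) :+ b) refl (f 0 * g 1) (f 1 * g 0)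
⊛-sucʳ f g (suc n) = begin
  f 0 * g (suc (suc n)) + ((f ∘ suc) ⊛ g) (suc n)
    ≡⟨ cong (f 0 * g (suc (suc n)) +_) (⊛-sucʳ (f ∘ suc) g n) ⟩
  f 0 * g (suc (suc n)) + (((f ∘ suc) ⊛ (g ∘ suc)) n + f (suc (suc n)) * g 0)
    ≡⟨ ℚ.+-assoc (f 0 * g (suc (suc n))) (((f ∘ suc) ⊛ (g ∘ suc)) n) (f (suc (suc n)) * g 0) ⟨
  (f ⊛ (g ∘ suc)) (suc n) + f (suc (suc n)) * g 0 ∎
  where open ≡-Reasoning

⊛-comm : ∀ f g → f ⊛ g ≗ g ⊛ f
⊛-comm f g zero    = cong (_+ 0ℚ) (ℚ.*-comm (f 0) (g 0))
⊛-comm f g (suc n) = begin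
  f 0 * g (suc n) + ((f ∘ suc) ⊛ g) n ≡⟨ cong₂ _+_ (ℚ.*-comm (f 0) (g (suc n))) (⊛-comm (f ∘ suc) g n) ⟩
  g (suc n) * f 0 + (g ⊛ (f ∘ suc)) n ≡⟨ ℚ.+-comm (g (suc n) * f 0) ((g ⊛ (f ∘ suc)) n) ⟩
  (g ⊛ (f ∘ suc)) n + g (suc n) * f 0 ≡⟨ ⊛-sucʳ g f n ⟨
  (g ⊛ f) (suc n) ∎
  where open ≡-Reasoning

-- By mere unfolding, the tail of `f ⊛ g` is `f 0` times the tail of `g` plus the tail of `f` times
-- `g`. Distributivity and induction on the degree do the rest.
⊛-assoc : ∀ f g h → (f ⊛ g) ⊛ h ≗ f ⊛ (g ⊛ h)
⊛-assoc f g h zero    =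
  solve 3 (λ a b c → (a :* b :+ con 0ℚ) :* c :+ con 0ℚ := a :* (b :* c :+ con 0ℚ) :+ con 0ℚ)
    refl (f 0) (g 0) (h 0)
⊛-assoc f g h (suc n) = begin
  (f ⊛ g) 0 * h (suc n) + (((f ⊛ g) ∘ suc) ⊛ h) n
    ≡⟨ cong ((f ⊛ g) 0 * h (suc n) +_)
         (⊛-distribʳ-⊕ h (λ k → f 0 * g (suc k)) ((f ∘ suc) ⊛ g) n) ⟩
  (f ⊛ g) 0 * h (suc n) + (((λ k → f 0 * g (suc k)) ⊛ h) n + (((f ∘ suc) ⊛ g) ⊛ h) n)
    ≡⟨ cong ((f ⊛ g) 0 * h (suc n) +_)
         (cong₂ _+_ (⊛-scaleˡ (f 0) (g ∘ suc) h n) (⊛-assoc (f ∘ suc) g h n)) ⟩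
  (f ⊛ g) 0 * h (suc n) + (f 0 * ((g ∘ suc) ⊛ h) n + ((f ∘ suc) ⊛ (g ⊛ h)) n)
    ≡⟨ solve 5 (λ a b c d e →
         (a :* b :+ con 0ℚ) :* c :+ (a :* d :+ e) := a :* (b :* c :+ d) :+ e)
         refl (f 0) (g 0) (h (suc n)) (((g ∘ suc) ⊛ h) n) (((f ∘ suc) ⊛ (g ⊛ h)) n) ⟩
  f 0 * (g ⊛ h) (suc n) + ((f ∘ suc) ⊛ (g ⊛ h)) n ∎
  where open ≡-Reasoning

⊛-identityˡ : ∀ f → κ 1ℚ ⊛ f ≗ f
⊛-identityˡ f n = trans (κ-⊛ 1ℚ f n) (ℚ.*-identityˡ (f n))

-- Equality is pointwise. The unit is `κ 1ℚ` rather than `𝟙`, so that `κ`, the coefficient morphism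
-- of the solver, preserves it by `refl`; `𝟙≗κ1` passes from one to the other.
seriesRing : CommutativeRing 0ℓ 0ℓ
seriesRing = record
  { Carrier = Series
  ; _≈_ = _≗_
  ; _+_ = _⊕_
  ; _*_ = _⊛_
  ; -_ = ⊖_
  ; 0# = κ 0ℚ
  ; 1# = κ 1ℚ
  ; isCommutativeRing = record
    { isRing = record
      { +-isAbelianGroup = record
        { isGroup = record
          { isMonoid = record
            { isSemigroup = record
              { isMagma = record
                { isEquivalence = record
                  { refl = λ _ → refl
                  ; sym = λ p n → sym (p n)
                  ; trans = λ p q n → trans (p n) (q n)
                  }
                ; ∙-cong = λ p q n → cong₂ _+_ (p n) (q n)
                }
              ; assoc = λ f g h n → ℚ.+-assoc (f n) (g n) (h n)
              }
            ; identity =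
                (λ { f zero → ℚ.+-identityˡ (f 0) ; f (suc n) → ℚ.+-identityˡ (f (suc n)) })
              , (λ { f zero → ℚ.+-identityʳ (f 0) ; f (suc n) → ℚ.+-identityʳ (f (suc n)) })
            }
          ; inverse =
              (λ { f zero → ℚ.+-inverseˡ (f 0) ; f (suc n) → ℚ.+-inverseˡ (f (suc n)) })
            , (λ { f zero → ℚ.+-inverseʳ (f 0) ; f (suc n) → ℚ.+-inverseʳ (f (suc n)) })
          ; ⁻¹-cong = λ p n → cong -_ (p n)
          }
        ; comm = λ f g n → ℚ.+-comm (f n) (g n)
        }
      ; *-cong = ⊛-cong
      ; *-assoc = ⊛-assoc
      ; *-identity = ⊛-identityˡ , (λ f n → trans (⊛-comm f (κ 1ℚ) n) (⊛-identityˡ f n))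
      ; distrib =
          (λ h f g n → trans (⊛-comm h (f ⊕ g) n)
            (trans (⊛-distribʳ-⊕ h f g n) (cong₂ _+_ (⊛-comm f h n) (⊛-comm g h n))))
        , ⊛-distribʳ-⊕
      }
    ; *-comm = ⊛-comm
    }
  }

ℚ⟶Series : CommutativeRing.rawRing ℚ.+-*-commutativeRing ACR.-Raw-AlmostCommutative⟶
           ACR.fromCommutativeRing seriesRing
ℚ⟶Series = record
  { ⟦_⟧ = κ
  ; +-homo = λ { a b zero → refl ; a b (suc n) → refl }
  ; *-homo = λ { a b zero → sym (κ-⊛ a (κ b) 0)
               ; a b (suc n) → sym (trans (κ-⊛ a (κ b) (suc n)) (ℚ.*-zeroʳ a)) }
  ; -‿homo = λ { a zero → refl ; a (suc n) → refl }
  ; 0-homo = λ _ → refl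
  ; 1-homo = λ _ → refl
  }

κ-≟ : ∀ a b → Dec (κ a ≗ κ b)
κ-≟ a b = map′ (λ { refl _ → refl }) (λ κa≗κb → κa≗κb 0) (a ℚ.≟ b)

module SeriesSolver = Algebra.Solver.Ring
  (CommutativeRing.rawRing ℚ.+-*-commutativeRing)
  (ACR.fromCommutativeRing seriesRing)
  ℚ⟶Series
  (dec⇒weaklyDec κ-≟)

module 𝕊 = CommutativeRing seriesRing

open SeriesSolver using () renaming
  (solve to solveₛ; _:=_ to _:≗_; _:+_ to _:⊕_; _:*_ to _:⊛_; :-_ to :⊖_; con to :κ)


-- Natural numbers as rationals

-- The arithmetic of `fromℕ` and `_/_` is checked on unnormalised rationals, where no reduction to
-- lowest terms intervenes.
toℚᵘ-fromℕ : ∀ n → toℚᵘ (fromℕ n) ℚᵘ.≃ mkℚᵘ (ℤ.+ n) 0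
toℚᵘ-fromℕ n = ℚ.toℚᵘ-fromℚᵘ (mkℚᵘ (ℤ.+ n) 0)

fromℕ-+ : ∀ m n → fromℕ (m ℕ.+ n) ≡ fromℕ m + fromℕ n
fromℕ-+ m n = ℚ.toℚᵘ-injective (begin
  toℚᵘ (fromℕ (m ℕ.+ n))             ≈⟨ toℚᵘ-fromℕ (m ℕ.+ n) ⟩
  mkℚᵘ (ℤ.+ (m ℕ.+ n)) 0               ≈⟨ *≡* (cong (ℤ._* ℤ.+ 1) (cong₂ ℤ._+_ (sym (ℤ.*-identityʳ (ℤ.+ m))) (sym (ℤ.*-identityʳ (ℤ.+ n))))) ⟩
  mkℚᵘ (ℤ.+ m) 0 ℚᵘ.+ mkℚᵘ (ℤ.+ n) 0     ≈⟨ ℚᵘ.+-cong (toℚᵘ-fromℕ m) (toℚᵘ-fromℕ n) ⟨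
  toℚᵘ (fromℕ m) ℚᵘ.+ toℚᵘ (fromℕ n) ≈⟨ ℚ.toℚᵘ-homo-+ (fromℕ m) (fromℕ n) ⟨
  toℚᵘ (fromℕ m + fromℕ n)           ∎)
  where open SetoidReasoning ℚᵘ.≃-setoid

fromℕ-* : ∀ m n → fromℕ (m ℕ.* n) ≡ fromℕ m * fromℕ n
fromℕ-* m n = ℚ.toℚᵘ-injective (begin
  toℚᵘ (fromℕ (m ℕ.* n))             ≈⟨ toℚᵘ-fromℕ (m ℕ.* n) ⟩
  mkℚᵘ (ℤ.+ (m ℕ.* n)) 0               ≈⟨ *≡* (cong (ℤ._* ℤ.+ 1) (ℤ.pos-* m n)) ⟩
  mkℚᵘ (ℤ.+ m) 0 ℚᵘ.* mkℚᵘ (ℤ.+ n) 0     ≈⟨ ℚᵘ.*-cong (toℚᵘ-fromℕ m) (toℚᵘ-fromℕ n) ⟨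
  toℚᵘ (fromℕ m) ℚᵘ.* toℚᵘ (fromℕ n) ≈⟨ ℚ.toℚᵘ-homo-* (fromℕ m) (fromℕ n) ⟨
  toℚᵘ (fromℕ m * fromℕ n)           ∎)
  where open SetoidReasoning ℚᵘ.≃-setoid

/-*-fromℕ : ∀ m n .{{_ : NonZero n}} → ℤ.+ m / n * fromℕ n ≡ fromℕ m
/-*-fromℕ m n@(suc n-1) = ℚ.toℚᵘ-injective (begin
  toℚᵘ (ℤ.+ m / n * fromℕ n)           ≈⟨ ℚ.toℚᵘ-homo-* (ℤ.+ m / n) (fromℕ n) ⟩
  toℚᵘ (ℤ.+ m / n) ℚᵘ.* toℚᵘ (fromℕ n) ≈⟨ ℚᵘ.*-cong (ℚ.toℚᵘ-fromℚᵘ (mkℚᵘ (ℤ.+ m) n-1)) (toℚᵘ-fromℕ n) ⟩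
  mkℚᵘ (ℤ.+ m) n-1 ℚᵘ.* mkℚᵘ (ℤ.+ n) 0   ≈⟨ *≡* (trans (ℤ.*-identityʳ (ℤ.+ m ℤ.* ℤ.+ n)) (cong (λ k → ℤ.+ m ℤ.* ℤ.+ k) (sym (ℕ.*-identityʳ n)))) ⟩
  mkℚᵘ (ℤ.+ m) 0                       ≈⟨ toℚᵘ-fromℕ m ⟨
  toℚᵘ (fromℕ m)                     ∎)
  where open SetoidReasoning ℚᵘ.≃-setoid

-- Serves to clear denominators, and to divide by the degree once `θ` has been applied.
*-cancelʳ-fromℕ : ∀ n .{{_ : NonZero n}} {x y} → x * fromℕ n ≡ y * fromℕ n → x ≡ y
*-cancelʳ-fromℕ n {x} {y} eq = begin
  x                         ≡⟨ lemma x ⟨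
  x * fromℕ n * (ℤ.+ 1 / n)   ≡⟨ cong (_* (ℤ.+ 1 / n)) eq ⟩
  y * fromℕ n * (ℤ.+ 1 / n)   ≡⟨ lemma y ⟩
  y                         ∎
  where
  open ≡-Reasoning
  lemma : ∀ z → z * fromℕ n * (ℤ.+ 1 / n) ≡ z
  lemma z = begin
    z * fromℕ n * (ℤ.+ 1 / n)   ≡⟨ ℚ.*-assoc z (fromℕ n) (ℤ.+ 1 / n) ⟩
    z * (fromℕ n * (ℤ.+ 1 / n)) ≡⟨ cong (z *_) (trans (ℚ.*-comm (fromℕ n) (ℤ.+ 1 / n)) (/-*-fromℕ 1 n)) ⟩
    z * 1ℚ                    ≡⟨ ℚ.*-identityʳ z ⟩
    z                         ∎

-- The Euler derivation t d/dt

θ : Series → Series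
θ f n = fromℕ n * f n

θ-cong : ∀ {f g} → f ≗ g → θ f ≗ θ g
θ-cong f≗g n = cong (fromℕ n *_) (f≗g n)

θ-⊕ : ∀ f g → θ (f ⊕ g) ≗ θ f ⊕ θ g
θ-⊕ f g n = ℚ.*-distribˡ-+ (fromℕ n) (f n) (g n)

-- Leibniz rule. As `θ` does not shift degrees, it holds term by term: the factor `n` splits as
-- `i + (n - i)`.
θ-⊛ : ∀ f g → θ (f ⊛ g) ≗ (θ f ⊛ g) ⊕ (f ⊛ θ g)
θ-⊛ f g n = begin
  fromℕ n * (f ⊛ g) n
    ≡⟨ *-distribˡ-sum {suc n} (fromℕ n) (λ i → f (toℕ i) * g (n ∸ toℕ i)) ⟩
  ∑[ i ≤ n ] (fromℕ n * (f (toℕ i) * g (n ∸ toℕ i)))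
    ≡⟨ sum-cong-≗ {suc n} term ⟩
  ∑[ i ≤ n ] (θ f (toℕ i) * g (n ∸ toℕ i) + f (toℕ i) * θ g (n ∸ toℕ i))
    ≡⟨ ∑-distrib-+ {suc n} (λ i → θ f (toℕ i) * g (n ∸ toℕ i)) (λ i → f (toℕ i) * θ g (n ∸ toℕ i)) ⟩
  ((θ f ⊛ g) ⊕ (f ⊛ θ g)) n ∎
  where
  open ≡-Reasoning
  term : ∀ (i : Fin (suc n)) → fromℕ n * (f (toℕ i) * g (n ∸ toℕ i)) ≡
         θ f (toℕ i) * g (n ∸ toℕ i) + f (toℕ i) * θ g (n ∸ toℕ i)
  term i = trans
    (cong (_* (f (toℕ i) * g (n ∸ toℕ i)))
      (trans (cong fromℕ (sym (ℕ.m+[n∸m]≡n (Fin.toℕ≤pred[n] i)))) (fromℕ-+ (toℕ i) (n ∸ toℕ i))))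
    (solve 4 (λ a b x y → (a :+ b) :* (x :* y) := (a :* x) :* y :+ x :* (b :* y)) refl
      (fromℕ (toℕ i)) (fromℕ (n ∸ toℕ i)) (f (toℕ i)) (g (n ∸ toℕ i)))

θ-κ : ∀ c → θ (κ c) ≗ κ 0ℚ
θ-κ c zero    = ℚ.*-zeroˡ c
θ-κ c (suc n) = ℚ.*-zeroʳ (fromℕ (suc n))

θ-κ⊛ : ∀ c f → θ (κ c ⊛ f) ≗ κ c ⊛ θ f
θ-κ⊛ c f n = begin
  fromℕ n * (κ c ⊛ f) n  ≡⟨ cong (fromℕ n *_) (κ-⊛ c f n) ⟩
  fromℕ n * (c * f n)    ≡⟨ solve 3 (λ a b c → a :* (b :* c) := b :* (a :* c)) refl (fromℕ n) c (f n) ⟩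
  c * (fromℕ n * f n)    ≡⟨ κ-⊛ c (θ f) n ⟨
  (κ c ⊛ θ f) n          ∎
  where open ≡-Reasoning

𝟙≗κ1 : 𝟙 ≗ κ 1ℚ
𝟙≗κ1 zero    = refl
𝟙≗κ1 (suc _) = refl

κ-+ : ∀ a b → κ (a + b) ≗ κ a ⊕ κ b
κ-+ a b zero    = refl
κ-+ a b (suc n) = refl

κ-fromℕ-suc : ∀ n → κ (fromℕ (suc n)) ≗ κ 1ℚ ⊕ κ (fromℕ n)
κ-fromℕ-suc n k = trans (cong (λ c → κ c k) (fromℕ-+ 1 n)) (κ-+ 1ℚ (fromℕ n) k)

θ-^ : ∀ f n → θ (f ^ suc n) ≗ (κ (fromℕ (suc n)) ⊛ f ^ n) ⊛ θ f
θ-^ f zero = begin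
  θ (f ⊛ 𝟙)                     ≈⟨ θ-cong (𝕊.*-congˡ {f} 𝟙≗κ1) ⟩
  θ (f ⊛ κ 1ℚ)                  ≈⟨ θ-⊛ f (κ 1ℚ) ⟩
  (θ f ⊛ κ 1ℚ) ⊕ (f ⊛ θ (κ 1ℚ)) ≈⟨ 𝕊.+-congˡ {θ f ⊛ κ 1ℚ} (𝕊.*-congˡ {f} (θ-κ 1ℚ)) ⟩
  (θ f ⊛ κ 1ℚ) ⊕ (f ⊛ κ 0ℚ)     ≈⟨ solveₛ 2 (λ f f′ → (f′ :⊛ :κ 1ℚ) :⊕ (f :⊛ :κ 0ℚ) :≗ (:κ 1ℚ :⊛ :κ 1ℚ) :⊛ f′) 𝕊.refl f (θ f) ⟩
  (κ 1ℚ ⊛ κ 1ℚ) ⊛ θ f           ≈⟨ 𝕊.*-congʳ {θ f} (𝕊.*-congˡ {κ 1ℚ} 𝟙≗κ1) ⟨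
  (κ (fromℕ 1) ⊛ 𝟙) ⊛ θ f       ∎
  where open SetoidReasoning 𝕊.setoid
θ-^ f (suc n) = begin
  θ (f ⊛ f ^ suc n)
    ≈⟨ θ-⊛ f (f ^ suc n) ⟩
  (θ f ⊛ f ^ suc n) ⊕ (f ⊛ θ (f ^ suc n))
    ≈⟨ 𝕊.+-congˡ {θ f ⊛ f ^ suc n} (𝕊.*-congˡ {f} (θ-^ f n)) ⟩
  (θ f ⊛ f ^ suc n) ⊕ (f ⊛ ((κ (fromℕ (suc n)) ⊛ f ^ n) ⊛ θ f))
    ≈⟨ solveₛ 4 (λ f f′ p k → (f′ :⊛ (f :⊛ p)) :⊕ (f :⊛ ((k :⊛ p) :⊛ f′)) :≗
         ((:κ 1ℚ :⊕ k) :⊛ (f :⊛ p)) :⊛ f′) 𝕊.refl f (θ f) (f ^ n) (κ (fromℕ (suc n))) ⟩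
  ((κ 1ℚ ⊕ κ (fromℕ (suc n))) ⊛ f ^ suc n) ⊛ θ f
    ≈⟨ 𝕊.*-congʳ {θ f} (𝕊.*-congʳ {f ^ suc n} (κ-fromℕ-suc (suc n))) ⟨
  (κ (fromℕ (suc (suc n))) ⊛ f ^ suc n) ⊛ θ f ∎
  where open SetoidReasoning 𝕊.setoid

-- Multiplication by t and the exponential series

𝕥-⊛-suc : ∀ f n → (𝕥 ⊛ f) (suc n) ≡ f n
𝕥-⊛-suc f n = begin
  0ℚ * f (suc n) + (𝟙 ⊛ f) n ≡⟨ cong (_+ (𝟙 ⊛ f) n) (ℚ.*-zeroˡ (f (suc n))) ⟩
  0ℚ + (𝟙 ⊛ f) n             ≡⟨ ℚ.+-identityˡ ((𝟙 ⊛ f) n) ⟩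
  (𝟙 ⊛ f) n                  ≡⟨ 𝕊.*-congʳ {f} 𝟙≗κ1 n ⟩
  (κ 1ℚ ⊛ f) n               ≡⟨ ⊛-identityˡ f n ⟩
  f n                        ∎
  where open ≡-Reasoning

𝕥-cancel : ∀ f → 𝕥 ⊛ f ≗ κ 0ℚ → f ≗ κ 0ℚ
𝕥-cancel f 𝕥f≗0 n = trans (sym (𝕥-⊛-suc f n)) (trans (𝕥f≗0 (suc n)) (κ0-0 n))
  where
  κ0-0 : ∀ n → 0ℚ ≡ κ 0ℚ n
  κ0-0 zero    = refl
  κ0-0 (suc n) = refl

θ-𝕥 : θ 𝕥 ≗ 𝕥
θ-𝕥 zero          = refl
θ-𝕥 (suc zero)    = refl
θ-𝕥 (suc (suc n)) = ℚ.*-zeroʳ (fromℕ (suc (suc n)))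

-- This is t (eᵗ)′ = t eᵗ, with `κ 1ℚ ⊕ eᵗ-1` in the role of eᵗ. In degree `suc n` it reduces to (n
-- + 1) / (n + 1)! = 1 / n!, checked after multiplication by `n !`.
θ-eᵗ-1 : θ eᵗ-1 ≗ 𝕥 ⊛ (κ 1ℚ ⊕ eᵗ-1)
θ-eᵗ-1 zero    = refl
θ-eᵗ-1 (suc n) = *-cancelʳ-fromℕ (n !) {{n ℕ.!≢0}} (begin
  fromℕ (suc n) * x * fromℕ (n !) ≡⟨ solve 3 (λ a x b → a :* x :* b := x :* (a :* b)) refl (fromℕ (suc n)) x (fromℕ (n !)) ⟩
  x * (fromℕ (suc n) * fromℕ (n !)) ≡⟨ cong (x *_) (fromℕ-* (suc n) (n !)) ⟨
  x * fromℕ (suc n !)             ≡⟨ /-*-fromℕ 1 (suc n !) {{suc n ℕ.!≢0}} ⟩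
  1ℚ                              ≡⟨ eᵗ n ⟨
  (κ 1ℚ ⊕ eᵗ-1) n * fromℕ (n !)   ≡⟨ cong (_* fromℕ (n !)) (𝕥-⊛-suc (κ 1ℚ ⊕ eᵗ-1) n) ⟨
  (𝕥 ⊛ (κ 1ℚ ⊕ eᵗ-1)) (suc n) * fromℕ (n !) ∎)
  where
  open ≡-Reasoning
  x = eᵗ-1 (suc n)
  eᵗ : ∀ n → (κ 1ℚ ⊕ eᵗ-1) n * fromℕ (n !) ≡ 1ℚ
  eᵗ zero    = refl
  eᵗ (suc n) = trans (cong (_* fromℕ (suc n !)) (ℚ.+-identityˡ (eᵗ-1 (suc n))))
                     (/-*-fromℕ 1 (suc n !) {{suc n ℕ.!≢0}})

-- The series of coefficients B_k^(k) / k!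

φ E : Series
φ = t/[eᵗ-1]
E = eᵗ-1

-- Obtained by applying θ to E φ = t and cancelling E.
θ-t/[eᵗ-1] : θ φ ≗ (φ ⊕ ⊖ (φ ⊛ φ)) ⊕ ⊖ (𝕥 ⊛ φ)
θ-t/[eᵗ-1] = begin
  θ φ           ≈⟨ solveₛ 2 (λ a b → a :≗ (a :⊕ :⊖ b) :⊕ b) 𝕊.refl (θ φ) rhs ⟩
  defect ⊕ rhs  ≈⟨ 𝕊.+-congʳ {rhs} (𝕥-cancel defect 𝕥⊛defect) ⟩
  κ 0ℚ ⊕ rhs    ≈⟨ 𝕊.+-identityˡ rhs ⟩
  rhs           ∎
  where
  open SetoidReasoning 𝕊.setoid
  rhs defect : Series
  rhs    = (φ ⊕ ⊖ (φ ⊛ φ)) ⊕ ⊖ (𝕥 ⊛ φ)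
  defect = θ φ ⊕ ⊖ rhs

  θ[Eφ] : (𝕥 ⊛ (κ 1ℚ ⊕ E)) ⊛ φ ⊕ E ⊛ θ φ ≗ 𝕥
  θ[Eφ] = begin
    (𝕥 ⊛ (κ 1ℚ ⊕ E)) ⊛ φ ⊕ E ⊛ θ φ ≈⟨ 𝕊.+-congʳ {E ⊛ θ φ} (𝕊.*-congʳ {φ} θ-eᵗ-1) ⟨
    θ E ⊛ φ ⊕ E ⊛ θ φ              ≈⟨ θ-⊛ E φ ⟨
    θ (E ⊛ φ)                      ≈⟨ θ-cong [eᵗ-1]⊛t/[eᵗ-1]≗t ⟩
    θ 𝕥                            ≈⟨ θ-𝕥 ⟩
    𝕥                              ∎

  E⊛defect : E ⊛ defect ≗ κ 0ℚ
  E⊛defect = begin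
    E ⊛ defect
      -- Regrouped so that `E` occurs only in the two known combinations, the expanded θ (E φ) and
      -- `E ⊛ φ`.
      ≈⟨ solveₛ 4 (λ t e p p′ →
           e :⊛ (p′ :⊕ :⊖ ((p :⊕ :⊖ (p :⊛ p)) :⊕ :⊖ (t :⊛ p))) :≗
           ((t :⊛ (:κ 1ℚ :⊕ e)) :⊛ p :⊕ e :⊛ p′) :⊕ :⊖ (t :⊛ p) :⊕ :⊖ (e :⊛ p) :⊕ (e :⊛ p) :⊛ p)
           𝕊.refl 𝕥 E φ (θ φ) ⟩
    ((𝕥 ⊛ (κ 1ℚ ⊕ E)) ⊛ φ ⊕ E ⊛ θ φ) ⊕ ⊖ (𝕥 ⊛ φ) ⊕ ⊖ (E ⊛ φ) ⊕ (E ⊛ φ) ⊛ φ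
      ≈⟨ 𝕊.+-cong (𝕊.+-cong (𝕊.+-congʳ {⊖ (𝕥 ⊛ φ)} θ[Eφ])
                            (𝕊.-‿cong [eᵗ-1]⊛t/[eᵗ-1]≗t))
                  (𝕊.*-congʳ {φ} [eᵗ-1]⊛t/[eᵗ-1]≗t) ⟩
    𝕥 ⊕ ⊖ (𝕥 ⊛ φ) ⊕ ⊖ 𝕥 ⊕ 𝕥 ⊛ φ
      ≈⟨ solveₛ 2 (λ t p → t :⊕ :⊖ (t :⊛ p) :⊕ :⊖ t :⊕ t :⊛ p :≗ :κ 0ℚ) 𝕊.refl 𝕥 φ ⟩
    κ 0ℚ ∎

  -- `E` has no constant term and hence no reciprocal. A further factor `φ` turns it into `𝕥`, which
  -- `𝕥-cancel` removes by shifting coefficients.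
  𝕥⊛defect : 𝕥 ⊛ defect ≗ κ 0ℚ
  𝕥⊛defect = begin
    𝕥 ⊛ defect       ≈⟨ 𝕊.*-congʳ {defect} [eᵗ-1]⊛t/[eᵗ-1]≗t ⟨
    (E ⊛ φ) ⊛ defect ≈⟨ solveₛ 3 (λ a b c → (a :⊛ b) :⊛ c :≗ b :⊛ (a :⊛ c)) 𝕊.refl E φ defect ⟩
    φ ⊛ (E ⊛ defect) ≈⟨ 𝕊.*-congˡ {φ} E⊛defect ⟩
    φ ⊛ κ 0ℚ         ≈⟨ 𝕊.zeroʳ φ ⟩
    κ 0ℚ             ∎

-- The power rule with the differential equation of `φ` substituted. The quadratic term raises the
-- exponent, so this relates consecutive powers of `φ`.
θ-t/[eᵗ-1]-^ : ∀ m → θ (φ ^ suc m) ≗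
  κ (fromℕ (suc m)) ⊛ ((φ ^ suc m ⊕ ⊖ (φ ^ suc (suc m))) ⊕ ⊖ (𝕥 ⊛ φ ^ suc m))
θ-t/[eᵗ-1]-^ m = begin
  θ (φ ^ suc m)
    ≈⟨ θ-^ φ m ⟩
  (κ (fromℕ (suc m)) ⊛ φ ^ m) ⊛ θ φ
    ≈⟨ 𝕊.*-congˡ {κ (fromℕ (suc m)) ⊛ φ ^ m} θ-t/[eᵗ-1] ⟩
  (κ (fromℕ (suc m)) ⊛ φ ^ m) ⊛ ((φ ⊕ ⊖ (φ ⊛ φ)) ⊕ ⊖ (𝕥 ⊛ φ))
    ≈⟨ solveₛ 4 (λ k p f t → (k :⊛ p) :⊛ ((f :⊕ :⊖ (f :⊛ f)) :⊕ :⊖ (t :⊛ f)) :≗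
         k :⊛ ((f :⊛ p :⊕ :⊖ (f :⊛ (f :⊛ p))) :⊕ :⊖ (t :⊛ (f :⊛ p))))
         𝕊.refl (κ (fromℕ (suc m))) (φ ^ m) φ 𝕥 ⟩
  κ (fromℕ (suc m)) ⊛ ((φ ^ suc m ⊕ ⊖ (φ ^ suc (suc m))) ⊕ ⊖ (𝕥 ⊛ φ ^ suc m)) ∎
  where open SetoidReasoning 𝕊.setoid

-- The series 1 / (1 + t).
alt : Series
alt zero    = 1ℚ
alt (suc n) = - alt n

-- Compare coefficients of tⁿ in `θ-t/[eᵗ-1]-^` for the exponent n = k + 1. The degree on the left
-- equals the exponent on the right and cancels; then [tⁿ] φⁿ drops out too, leaving [tⁿ] φⁿ⁺¹ = -
-- [tⁿ⁻¹] φⁿ.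
[t^k]φ^[1+k] : ∀ k → (φ ^ suc k) k ≡ alt k
[t^k]φ^[1+k] zero    = refl
[t^k]φ^[1+k] (suc k) = begin
  z                           ≡⟨ solve 3 (λ x y z → z := :- y :+ (x :+ :- ((x :+ :- z) :+ :- y))) refl x y z ⟩
  - y + (x + - (x + - z + - y)) ≡⟨ cong (λ w → - y + (x + - w)) (sym x≡) ⟩
  - y + (x + - x)             ≡⟨ solve 2 (λ x y → :- y :+ (x :+ :- x) := :- y) refl x y ⟩
  - y                         ≡⟨ cong -_ ([t^k]φ^[1+k] k) ⟩
  - alt k                     ∎
  where
  open ≡-Reasoning
  n = suc k
  x = (φ ^ n) n
  y = (φ ^ n) k
  z = (φ ^ suc n) n
  x≡ : x ≡ x + - z + - y
  x≡ = *-cancelʳ-fromℕ n (begin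
    x * fromℕ n                 ≡⟨ ℚ.*-comm x (fromℕ n) ⟩
    θ (φ ^ n) n                 ≡⟨ θ-t/[eᵗ-1]-^ k n ⟩
    (κ (fromℕ n) ⊛ ((φ ^ n ⊕ ⊖ (φ ^ suc n)) ⊕ ⊖ (𝕥 ⊛ φ ^ n))) n
      ≡⟨ κ-⊛ (fromℕ n) ((φ ^ n ⊕ ⊖ (φ ^ suc n)) ⊕ ⊖ (𝕥 ⊛ φ ^ n)) n ⟩
    fromℕ n * (x + - z + - (𝕥 ⊛ φ ^ n) n)
      ≡⟨ cong (λ w → fromℕ n * (x + - z + - w)) (𝕥-⊛-suc (φ ^ n) k) ⟩
    fromℕ n * (x + - z + - y)   ≡⟨ ℚ.*-comm (fromℕ n) (x + - z + - y) ⟩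
    (x + - z + - y) * fromℕ n   ∎)

-- The truncated logarithm and the product of `L` and `G`

-- log (1 + t) / t
L : Series
L n = alt n * (ℤ.+ 1 / suc n)

[1+n]*L : ∀ n → fromℕ (suc n) * L n ≡ alt n
[1+n]*L n = begin
  fromℕ (suc n) * (alt n * (ℤ.+ 1 / suc n)) ≡⟨ solve 3 (λ a b c → a :* (b :* c) := b :* (c :* a)) refl (fromℕ (suc n)) (alt n) (ℤ.+ 1 / suc n) ⟩
  alt n * (ℤ.+ 1 / suc n * fromℕ (suc n))   ≡⟨ cong (alt n *_) (/-*-fromℕ 1 (suc n)) ⟩
  alt n * 1ℚ                              ≡⟨ ℚ.*-identityʳ (alt n) ⟩
  alt n                                   ∎
  where open ≡-Reasoning

-- The truncation Σ_{i<n} L i Eⁱ⁺¹ of log (1 + E) = t.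
logE : ℕ → Series
logE zero    = κ 0ℚ
logE (suc n) = logE n ⊕ κ (L n) ⊛ E ^ suc n

-- Differentiating the truncated logarithm gives θ E times the geometric sum of (-E)ⁱ over i < n.
-- Since θ E = t (1 + E), the factor 1 + E makes that sum telescope to 1 - (-E)ⁿ.
θ-logE : ∀ n → θ (logE n) ≗ 𝕥 ⊛ (κ 1ℚ ⊕ ⊖ (κ (alt n) ⊛ E ^ n))
θ-logE zero = begin
  θ (κ 0ℚ)                           ≈⟨ θ-κ 0ℚ ⟩
  κ 0ℚ                               ≈⟨ solveₛ 1 (λ t → :κ 0ℚ :≗ t :⊛ (:κ 1ℚ :⊕ :⊖ (:κ 1ℚ :⊛ :κ 1ℚ))) 𝕊.refl 𝕥 ⟩
  𝕥 ⊛ (κ 1ℚ ⊕ ⊖ (κ 1ℚ ⊛ κ 1ℚ))       ≈⟨ 𝕊.*-congˡ {𝕥} (𝕊.+-congˡ {κ 1ℚ} (𝕊.-‿cong (𝕊.*-congˡ {κ 1ℚ} 𝟙≗κ1))) ⟨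
  𝕥 ⊛ (κ 1ℚ ⊕ ⊖ (κ (alt 0) ⊛ E ^ 0)) ∎
  where open SetoidReasoning 𝕊.setoid
θ-logE (suc n) = begin
  θ (logE n ⊕ κ (L n) ⊛ E ^ suc n)
    ≈⟨ θ-⊕ (logE n) (κ (L n) ⊛ E ^ suc n) ⟩
  θ (logE n) ⊕ θ (κ (L n) ⊛ E ^ suc n)
    ≈⟨ 𝕊.+-cong (θ-logE n) (𝕊.trans (θ-κ⊛ (L n) (E ^ suc n)) (𝕊.*-congˡ {κ (L n)}
         (𝕊.trans (θ-^ E n) (𝕊.*-congˡ {κ (fromℕ (suc n)) ⊛ E ^ n} θ-eᵗ-1)))) ⟩
  𝕥 ⊛ (κ 1ℚ ⊕ ⊖ (κ (alt n) ⊛ E ^ n)) ⊕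
    κ (L n) ⊛ ((κ (fromℕ (suc n)) ⊛ E ^ n) ⊛ (𝕥 ⊛ (κ 1ℚ ⊕ E)))
    ≈⟨ solveₛ 6 (λ t a p l k e →
         t :⊛ (:κ 1ℚ :⊕ :⊖ (a :⊛ p)) :⊕ l :⊛ ((k :⊛ p) :⊛ (t :⊛ (:κ 1ℚ :⊕ e))) :≗
         t :⊛ (:κ 1ℚ :⊕ :⊖ (a :⊛ p)) :⊕ (k :⊛ l) :⊛ (p :⊛ (t :⊛ (:κ 1ℚ :⊕ e))))
         𝕊.refl 𝕥 (κ (alt n)) (E ^ n) (κ (L n)) (κ (fromℕ (suc n))) E ⟩
  𝕥 ⊛ (κ 1ℚ ⊕ ⊖ (κ (alt n) ⊛ E ^ n)) ⊕
    (κ (fromℕ (suc n)) ⊛ κ (L n)) ⊛ (E ^ n ⊛ (𝕥 ⊛ (κ 1ℚ ⊕ E)))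
    ≈⟨ 𝕊.+-congˡ {𝕥 ⊛ (κ 1ℚ ⊕ ⊖ (κ (alt n) ⊛ E ^ n))}
         (𝕊.*-congʳ {E ^ n ⊛ (𝕥 ⊛ (κ 1ℚ ⊕ E))} κ[1+n]⊛κL) ⟩
  𝕥 ⊛ (κ 1ℚ ⊕ ⊖ (κ (alt n) ⊛ E ^ n)) ⊕ κ (alt n) ⊛ (E ^ n ⊛ (𝕥 ⊛ (κ 1ℚ ⊕ E)))
    ≈⟨ solveₛ 4 (λ t a p e →
         t :⊛ (:κ 1ℚ :⊕ :⊖ (a :⊛ p)) :⊕ a :⊛ (p :⊛ (t :⊛ (:κ 1ℚ :⊕ e))) :≗
         t :⊛ (:κ 1ℚ :⊕ :⊖ ((:⊖ a) :⊛ (e :⊛ p))))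
         𝕊.refl 𝕥 (κ (alt n)) (E ^ n) E ⟩
  𝕥 ⊛ (κ 1ℚ ⊕ ⊖ ((⊖ κ (alt n)) ⊛ E ^ suc n))
    ≈⟨ 𝕊.*-congˡ {𝕥} (𝕊.+-congˡ {κ 1ℚ} (𝕊.-‿cong (𝕊.*-congʳ {E ^ suc n} (κ-neg (alt n))))) ⟨
  𝕥 ⊛ (κ 1ℚ ⊕ ⊖ (κ (alt (suc n)) ⊛ E ^ suc n)) ∎
  where
  open SetoidReasoning 𝕊.setoid
  κ-neg : ∀ a → κ (- a) ≗ ⊖ κ a
  κ-neg a zero    = refl
  κ-neg a (suc _) = refl
  κ[1+n]⊛κL : κ (fromℕ (suc n)) ⊛ κ (L n) ≗ κ (alt n)
  κ[1+n]⊛κL zero    = trans (κ-⊛ (fromℕ (suc n)) (κ (L n)) 0) ([1+n]*L n)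
  κ[1+n]⊛κL (suc m) = trans (κ-⊛ (fromℕ (suc n)) (κ (L n)) (suc m)) (ℚ.*-zeroʳ (fromℕ (suc n)))

⊛-vanish : ∀ f g n → (∀ k → k ≤ n → g k ≡ 0ℚ) → (f ⊛ g) n ≡ 0ℚ
⊛-vanish f g n g≡0 = trans
  (sum-cong-≗ {suc n} λ i → trans (cong (f (toℕ i) *_) (g≡0 (n ∸ toℕ i) (ℕ.m∸n≤m n (toℕ i)))) (ℚ.*-zeroʳ (f (toℕ i))))
  (sum-replicate-zero (suc n))

-- Each factor of the power contributes at least one power of t.
^-vanish : ∀ f → f 0 ≡ 0ℚ → ∀ n k → k < n → (f ^ n) k ≡ 0ℚ
^-vanish f f₀≡0 (suc n) zero    _         = trans (cong (λ x → x * (f ^ n) 0 + 0ℚ) f₀≡0) (trans (ℚ.+-identityʳ (0ℚ * (f ^ n) 0)) (ℚ.*-zeroˡ ((f ^ n) 0)))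
^-vanish f f₀≡0 (suc n) (suc k) (s≤s k<n) = cong₂ _+_
  (trans (cong (_* (f ^ n) (suc k)) f₀≡0) (ℚ.*-zeroˡ ((f ^ n) (suc k))))
  (⊛-vanish (f ∘ suc) (f ^ n) k λ j j≤k → ^-vanish f f₀≡0 n j (ℕ.≤-<-trans j≤k k<n))

-- By `θ-logE`, the error of θ (logE n) against t is t Eⁿ up to sign, which starts in degree n + 1.
-- In positive degree `θ` is undone by division by the degree; it loses the constant term, which is
-- therefore checked directly.
logE≡𝕥 : ∀ n k → k ≤ n → logE n k ≡ 𝕥 k
logE≡𝕥 n zero    _   = logE-0 n
  where
  logE-0 : ∀ n → logE n 0 ≡ 0ℚ
  logE-0 zero    = refl
  logE-0 (suc n) = cong₂ _+_ (logE-0 n) (trans (κ-⊛ (L n) (E ^ suc n) 0)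
    (trans (cong (L n *_) (^-vanish E refl (suc n) 0 (s≤s z≤n))) (ℚ.*-zeroʳ (L n))))
logE≡𝕥 n (suc k) k<n = *-cancelʳ-fromℕ (suc k) (begin
  logE n (suc k) * fromℕ (suc k)         ≡⟨ ℚ.*-comm (logE n (suc k)) (fromℕ (suc k)) ⟩
  θ (logE n) (suc k)                     ≡⟨ θ-logE n (suc k) ⟩
  (𝕥 ⊛ (κ 1ℚ ⊕ ⊖ (κ (alt n) ⊛ E ^ n))) (suc k) ≡⟨ 𝕥-⊛-suc (κ 1ℚ ⊕ ⊖ (κ (alt n) ⊛ E ^ n)) k ⟩
  κ 1ℚ k + - (κ (alt n) ⊛ E ^ n) k       ≡⟨ cong (λ x → κ 1ℚ k + - x)
                                              (⊛-vanish (κ (alt n)) (E ^ n) k λ j j≤k → ^-vanish E refl n j (ℕ.≤-<-trans j≤k k<n)) ⟩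
  κ 1ℚ k + 0ℚ                            ≡⟨ ℚ.+-identityʳ (κ 1ℚ k) ⟩
  κ 1ℚ k                                 ≡⟨ 𝟙≗κ1 k ⟨
  𝟙 k                                    ≡⟨ θ-𝕥 (suc k) ⟨
  fromℕ (suc k) * 𝟙 k                    ≡⟨ ℚ.*-comm (fromℕ (suc k)) (𝟙 k) ⟩
  𝟙 k * fromℕ (suc k)                    ∎)
  where open ≡-Reasoning

-- Each of the `j` factors `E` is paired with one factor `φ`, and E φ = t.
φ^[j+i]⊛E^j : ∀ j i → φ ^ (j ℕ.+ i) ⊛ E ^ j ≗ 𝕥 ^ j ⊛ φ ^ i
φ^[j+i]⊛E^j zero    i = 𝕊.*-comm (φ ^ i) 𝟙
φ^[j+i]⊛E^j (suc j) i = begin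
  φ ⊛ φ ^ (j ℕ.+ i) ⊛ (E ⊛ E ^ j)
    ≈⟨ solveₛ 4 (λ p q e r → p :⊛ q :⊛ (e :⊛ r) :≗ (e :⊛ p) :⊛ (q :⊛ r)) 𝕊.refl φ (φ ^ (j ℕ.+ i)) E (E ^ j) ⟩
  (E ⊛ φ) ⊛ (φ ^ (j ℕ.+ i) ⊛ E ^ j)
    ≈⟨ 𝕊.*-cong [eᵗ-1]⊛t/[eᵗ-1]≗t (φ^[j+i]⊛E^j j i) ⟩
  𝕥 ⊛ (𝕥 ^ j ⊛ φ ^ i)
    ≈⟨ 𝕊.*-assoc 𝕥 (𝕥 ^ j) (φ ^ i) ⟨
  𝕥 ^ suc j ⊛ φ ^ i ∎
  where open SetoidReasoning 𝕊.setoid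

𝕥^-⊛ : ∀ j f n → (𝕥 ^ j ⊛ f) (j ℕ.+ n) ≡ f n
𝕥^-⊛ zero    f n = trans (𝕊.*-congʳ {f} 𝟙≗κ1 n) (⊛-identityˡ f n)
𝕥^-⊛ (suc j) f n = begin
  (𝕥 ⊛ 𝕥 ^ j ⊛ f) (suc (j ℕ.+ n))   ≡⟨ 𝕊.*-assoc 𝕥 (𝕥 ^ j) f (suc (j ℕ.+ n)) ⟩
  (𝕥 ⊛ (𝕥 ^ j ⊛ f)) (suc (j ℕ.+ n)) ≡⟨ 𝕥-⊛-suc (𝕥 ^ j ⊛ f) (j ℕ.+ n) ⟩
  (𝕥 ^ j ⊛ f) (j ℕ.+ n)             ≡⟨ 𝕥^-⊛ j f n ⟩
  f n                               ∎
  where open ≡-Reasoning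

-- G k = bernoulli k k / k!
G : Series
G k = (φ ^ k) k

-- The product is tⁱ⁺¹ φᵏ⁻ⁱ, so exponent and degree drop by the same amount and the coefficient
-- stays on the diagonal that defines `G`.
[t^[1+k]]φ^[1+k]E^[1+i] : ∀ {i k} → i ≤ k → (φ ^ suc k ⊛ E ^ suc i) (suc k) ≡ G (k ∸ i)
[t^[1+k]]φ^[1+k]E^[1+i] {i} {k} i≤k = subst (λ n → (φ ^ suc n ⊛ E ^ suc i) (suc n) ≡ G (k ∸ i))
  (ℕ.m+[n∸m]≡n i≤k)
  (trans (φ^[j+i]⊛E^j (suc i) (k ∸ i) (suc i ℕ.+ (k ∸ i))) (𝕥^-⊛ (suc i) (φ ^ (k ∸ i)) (k ∸ i)))

sum-suc : ∀ (f : ℕ → ℚ) n → ∑[ i < suc n ] f (toℕ i) ≡ ∑[ i < n ] f (toℕ i) + f n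
sum-suc f zero    = ℚ.+-comm (f 0) 0ℚ
sum-suc f (suc n) = trans (cong (f 0 +_) (sum-suc (f ∘ suc) n))
  (sym (ℚ.+-assoc (f 0) (∑[ i < n ] f (suc (toℕ i))) (f (suc n))))

-- Term by term in the truncated logarithm. The bound on `n` ensures i ≤ k for every index, as the
-- diagonal coefficient requires.
[t^[1+k]]φ^[1+k]logE : ∀ k n → n ≤ suc k →
  (φ ^ suc k ⊛ logE n) (suc k) ≡ ∑[ i < n ] (L (toℕ i) * G (k ∸ toℕ i))
[t^[1+k]]φ^[1+k]logE k zero    _         = 𝕊.zeroʳ (φ ^ suc k) (suc k)
[t^[1+k]]φ^[1+k]logE k (suc n) (s≤s n≤k) = begin
  (f ⊛ (logE n ⊕ κ (L n) ⊛ E ^ suc n)) (suc k)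
    ≡⟨ solveₛ 4 (λ f p l e → f :⊛ (p :⊕ l :⊛ e) :≗ f :⊛ p :⊕ l :⊛ (f :⊛ e)) 𝕊.refl f (logE n) (κ (L n)) (E ^ suc n) (suc k) ⟩
  (f ⊛ logE n) (suc k) + (κ (L n) ⊛ (f ⊛ E ^ suc n)) (suc k)
    ≡⟨ cong₂ _+_ ([t^[1+k]]φ^[1+k]logE k n (ℕ.m≤n⇒m≤1+n n≤k)) (κ-⊛ (L n) (f ⊛ E ^ suc n) (suc k)) ⟩
  ∑[ i < n ] (L (toℕ i) * G (k ∸ toℕ i)) + L n * (f ⊛ E ^ suc n) (suc k)
    ≡⟨ cong (λ x → ∑[ i < n ] (L (toℕ i) * G (k ∸ toℕ i)) + L n * x) ([t^[1+k]]φ^[1+k]E^[1+i] n≤k) ⟩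
  ∑[ i < n ] (L (toℕ i) * G (k ∸ toℕ i)) + L n * G (k ∸ n)
    ≡⟨ sum-suc (λ i → L i * G (k ∸ i)) n ⟨
  ∑[ i < suc n ] (L (toℕ i) * G (k ∸ toℕ i)) ∎
  where
  open ≡-Reasoning
  f = φ ^ suc k

-- Computes [tᵏ⁺¹] φᵏ⁺¹ log (1 + E) in two ways: term by term it is the convolution of `L` and `G`,
-- while log (1 + E) = t makes it [tᵏ] φᵏ⁺¹.
L⊛G : L ⊛ G ≗ alt
L⊛G k = begin
  (L ⊛ G) k                              ≡⟨ [t^[1+k]]φ^[1+k]logE k (suc k) ℕ.≤-refl ⟨
  -- Only coefficients of degree at most k + 1 of the second factor enter, and up to there the
  -- truncation agrees with t.
  (φ ^ suc k ⊛ logE (suc k)) (suc k)     ≡⟨ sum-cong-≗ {suc (suc k)} (λ i →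
                                              cong ((φ ^ suc k) (toℕ i) *_) (logE≡𝕥 (suc k) (suc k ∸ toℕ i) (ℕ.m∸n≤m (suc k) (toℕ i)))) ⟩
  (φ ^ suc k ⊛ 𝕥) (suc k)                ≡⟨ ⊛-comm (φ ^ suc k) 𝕥 (suc k) ⟩
  (𝕥 ⊛ φ ^ suc k) (suc k)                ≡⟨ 𝕥-⊛-suc (φ ^ suc k) k ⟩
  (φ ^ suc k) k                          ≡⟨ [t^k]φ^[1+k] k ⟩
  alt k                                  ∎
  where open ≡-Reasoning

-- The series t / log (1 + t) and its powers

1+𝕥 : Series
1+𝕥 = κ 1ℚ ⊕ 𝕥

[1+𝕥]⊛-suc : ∀ f n → (1+𝕥 ⊛ f) (suc n) ≡ f (suc n) + f n
[1+𝕥]⊛-suc f n = trans (𝕊.distribʳ f (κ 1ℚ) 𝕥 (suc n)) (cong₂ _+_ (⊛-identityˡ f (suc n)) (𝕥-⊛-suc f n))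

[1+𝕥]⊛-zero : ∀ f → (1+𝕥 ⊛ f) 0 ≡ f 0
[1+𝕥]⊛-zero f = trans (ℚ.+-identityʳ (1ℚ * f 0)) (ℚ.*-identityˡ (f 0))

[1+𝕥]⊛alt : 1+𝕥 ⊛ alt ≗ κ 1ℚ
[1+𝕥]⊛alt zero    = refl
[1+𝕥]⊛alt (suc n) = trans ([1+𝕥]⊛-suc alt n) (ℚ.+-inverseˡ (alt n))

-- t / log (1 + t)
Q : Series
Q = 1+𝕥 ⊛ G

L⊛Q : L ⊛ Q ≗ κ 1ℚ
L⊛Q = begin
  L ⊛ (1+𝕥 ⊛ G) ≈⟨ solveₛ 3 (λ a b c → a :⊛ (b :⊛ c) :≗ b :⊛ (a :⊛ c)) 𝕊.refl L 1+𝕥 G ⟩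
  1+𝕥 ⊛ (L ⊛ G) ≈⟨ 𝕊.*-congˡ {1+𝕥} L⊛G ⟩
  1+𝕥 ⊛ alt     ≈⟨ [1+𝕥]⊛alt ⟩
  κ 1ℚ          ∎
  where open SetoidReasoning 𝕊.setoid

-- `L ⊕ θ L` is the derivative of t L = log (1 + t), that is, 1 / (1 + t).
[1+𝕥]⊛[L+θL] : 1+𝕥 ⊛ (L ⊕ θ L) ≗ κ 1ℚ
[1+𝕥]⊛[L+θL] = 𝕊.trans (𝕊.*-congˡ {1+𝕥} L+θL) [1+𝕥]⊛alt
  where
  L+θL : L ⊕ θ L ≗ alt
  L+θL n = begin
    L n + fromℕ n * L n  ≡⟨ solve 2 (λ a b → a :+ b :* a := (con 1ℚ :+ b) :* a) refl (L n) (fromℕ n) ⟩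
    (1ℚ + fromℕ n) * L n ≡⟨ cong (_* L n) (fromℕ-+ 1 n) ⟨
    fromℕ (suc n) * L n  ≡⟨ [1+n]*L n ⟩
    alt n                ∎
    where open ≡-Reasoning

-- Multiply Q² by 1 = (1 + t) (L + θ L). From L Q = 1 come Q² L = Q and, on applying `θ`, Q² θ L = -
-- θ Q.
Q⊛Q : Q ⊛ Q ≗ 1+𝕥 ⊛ (Q ⊕ ⊖ θ Q)
Q⊛Q = begin
  Q ⊛ Q
    ≈⟨ 𝕊.*-identityˡ (Q ⊛ Q) ⟨
  κ 1ℚ ⊛ (Q ⊛ Q)
    ≈⟨ 𝕊.*-congʳ {Q ⊛ Q} [1+𝕥]⊛[L+θL] ⟨
  (1+𝕥 ⊛ (L ⊕ θ L)) ⊛ (Q ⊛ Q)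
    ≈⟨ solveₛ 5 (λ u l l′ q q′ → (u :⊛ (l :⊕ l′)) :⊛ (q :⊛ q) :≗
         u :⊛ (q :⊛ (l :⊛ q) :⊕ (q :⊛ (l′ :⊛ q :⊕ l :⊛ q′) :⊕ :⊖ ((l :⊛ q) :⊛ q′)))) 𝕊.refl 1+𝕥 L (θ L) Q (θ Q) ⟩
  1+𝕥 ⊛ (Q ⊛ (L ⊛ Q) ⊕ (Q ⊛ (θ L ⊛ Q ⊕ L ⊛ θ Q) ⊕ ⊖ ((L ⊛ Q) ⊛ θ Q)))
    ≈⟨ 𝕊.*-congˡ {1+𝕥} (𝕊.+-cong (𝕊.*-congˡ {Q} L⊛Q) (𝕊.+-cong (𝕊.*-congˡ {Q} θ[L⊛Q]) (𝕊.-‿cong (𝕊.*-congʳ {θ Q} L⊛Q)))) ⟩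
  1+𝕥 ⊛ (Q ⊛ κ 1ℚ ⊕ (Q ⊛ κ 0ℚ ⊕ ⊖ (κ 1ℚ ⊛ θ Q)))
    ≈⟨ solveₛ 3 (λ u q q′ → u :⊛ (q :⊛ :κ 1ℚ :⊕ (q :⊛ :κ 0ℚ :⊕ :⊖ (:κ 1ℚ :⊛ q′))) :≗ u :⊛ (q :⊕ :⊖ q′)) 𝕊.refl 1+𝕥 Q (θ Q) ⟩
  1+𝕥 ⊛ (Q ⊕ ⊖ θ Q) ∎
  where
  open SetoidReasoning 𝕊.setoid
  θ[L⊛Q] : θ L ⊛ Q ⊕ L ⊛ θ Q ≗ κ 0ℚ
  θ[L⊛Q] = begin
    θ L ⊛ Q ⊕ L ⊛ θ Q ≈⟨ θ-⊛ L Q ⟨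
    θ (L ⊛ Q)         ≈⟨ θ-cong L⊛Q ⟩
    θ (κ 1ℚ)          ≈⟨ θ-κ 1ℚ ⟩
    κ 0ℚ              ∎

-- `Q⊛Q` multiplied by (m + 1) Qᵐ, where (m + 1) Qᵐ θ Q is θ (Qᵐ⁺¹) by the power rule.
Q^-ODE : ∀ m → κ (fromℕ (suc m)) ⊛ Q ^ suc (suc m) ⊕ 1+𝕥 ⊛ θ (Q ^ suc m) ≗
  1+𝕥 ⊛ (κ (fromℕ (suc m)) ⊛ Q ^ suc m)
Q^-ODE m = begin
  k ⊛ Q ^ suc (suc m) ⊕ 1+𝕥 ⊛ θ (Q ^ suc m)
    ≈⟨ 𝕊.+-congˡ {k ⊛ Q ^ suc (suc m)} (𝕊.*-congˡ {1+𝕥} (θ-^ Q m)) ⟩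
  k ⊛ Q ^ suc (suc m) ⊕ 1+𝕥 ⊛ ((k ⊛ Q ^ m) ⊛ θ Q)
    ≈⟨ 𝕊.+-congʳ {1+𝕥 ⊛ ((k ⊛ Q ^ m) ⊛ θ Q)} (𝕊.*-congˡ {k}
         (𝕊.trans (𝕊.sym (𝕊.*-assoc Q Q (Q ^ m))) (𝕊.*-congʳ {Q ^ m} Q⊛Q))) ⟩
  k ⊛ ((1+𝕥 ⊛ (Q ⊕ ⊖ θ Q)) ⊛ Q ^ m) ⊕ 1+𝕥 ⊛ ((k ⊛ Q ^ m) ⊛ θ Q)
    ≈⟨ solveₛ 5 (λ k u q q′ p → k :⊛ ((u :⊛ (q :⊕ :⊖ q′)) :⊛ p) :⊕ u :⊛ ((k :⊛ p) :⊛ q′) :≗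
         u :⊛ (k :⊛ (q :⊛ p))) 𝕊.refl k 1+𝕥 Q (θ Q) (Q ^ m) ⟩
  1+𝕥 ⊛ (k ⊛ Q ^ suc m) ∎
  where
  open SetoidReasoning 𝕊.setoid
  k = κ (fromℕ (suc m))

-- The coefficient of tᵈ⁺¹ in `Q^-ODE` for m = l + d. The weights are what remains of m + 1 after
-- the degree is subtracted: (m + 1) - d = l + 1 and (m + 1) - (d + 1) = l.
Q^-rec : ∀ l d →
  fromℕ (suc (l ℕ.+ d)) * (Q ^ suc (suc (l ℕ.+ d))) (suc d) ≡
  fromℕ (suc l) * (Q ^ suc (l ℕ.+ d)) d + fromℕ l * (Q ^ suc (l ℕ.+ d)) (suc d)
Q^-rec l d = begin
  N * z
    ≡⟨ solve 2 (λ a b → a := (a :+ b) :+ :- b) refl (N * z) (fromℕ (suc d) * x + fromℕ d * y) ⟩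
  N * z + (fromℕ (suc d) * x + fromℕ d * y) + - (fromℕ (suc d) * x + fromℕ d * y)
    ≡⟨ cong (_+ - (fromℕ (suc d) * x + fromℕ d * y)) ODE ⟩
  N * x + N * y + - (fromℕ (suc d) * x + fromℕ d * y)
    ≡⟨ cong₂ (λ a b → a * x + a * y + - (b * x + fromℕ d * y))
         (trans (fromℕ-+ 1 (l ℕ.+ d)) (cong (1ℚ +_) (fromℕ-+ l d))) (fromℕ-+ 1 d) ⟩
  (1ℚ + (fromℕ l + fromℕ d)) * x + (1ℚ + (fromℕ l + fromℕ d)) * y + - ((1ℚ + fromℕ d) * x + fromℕ d * y)
    ≡⟨ solve 4 (λ l d x y →
         (con 1ℚ :+ (l :+ d)) :* x :+ (con 1ℚ :+ (l :+ d)) :* y :+ :- ((con 1ℚ :+ d) :* x :+ d :* y) :=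
         (con 1ℚ :+ l) :* y :+ l :* x) refl (fromℕ l) (fromℕ d) x y ⟩
  (1ℚ + fromℕ l) * y + fromℕ l * x
    ≡⟨ cong (λ a → a * y + fromℕ l * x) (fromℕ-+ 1 l) ⟨
  fromℕ (suc l) * y + fromℕ l * x ∎
  where
  open ≡-Reasoning
  m = l ℕ.+ d
  N = fromℕ (suc m)
  x = (Q ^ suc m) (suc d)
  y = (Q ^ suc m) d
  z = (Q ^ suc (suc m)) (suc d)
  ODE : N * z + (fromℕ (suc d) * x + fromℕ d * y) ≡ N * x + N * y
  ODE = begin
    N * z + (fromℕ (suc d) * x + fromℕ d * y)
      ≡⟨ cong₂ _+_ (κ-⊛ N (Q ^ suc (suc m)) (suc d)) ([1+𝕥]⊛-suc (θ (Q ^ suc m)) d) ⟨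
    (κ N ⊛ Q ^ suc (suc m) ⊕ 1+𝕥 ⊛ θ (Q ^ suc m)) (suc d)
      ≡⟨ Q^-ODE m (suc d) ⟩
    (1+𝕥 ⊛ (κ N ⊛ Q ^ suc m)) (suc d)
      ≡⟨ [1+𝕥]⊛-suc (κ N ⊛ Q ^ suc m) d ⟩
    (κ N ⊛ Q ^ suc m) (suc d) + (κ N ⊛ Q ^ suc m) d
      ≡⟨ cong₂ _+_ (κ-⊛ N (Q ^ suc m) (suc d)) (κ-⊛ N (Q ^ suc m) d) ⟩
    N * x + N * y ∎

Q^-zero : ∀ n → (Q ^ n) 0 ≡ 1ℚ
Q^-zero zero    = refl
Q^-zero (suc n) = trans (ℚ.+-identityʳ (Q 0 * (Q ^ n) 0)) (trans (cong (Q 0 *_) (Q^-zero n)) refl)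

-- Stirling numbers and the powers of `Q`

S₂-> : ∀ n i → S₂ n (suc (n ℕ.+ i)) ≡ 0
S₂-> zero    i = refl
S₂-> (suc n) i = cong₂ ℕ._+_
  (trans (cong (λ x → suc (suc (n ℕ.+ i)) ℕ.* x) (trans (cong (S₂ n) (cong suc (sym (ℕ.+-suc n i)))) (S₂-> n (suc i))))
         (ℕ.*-zeroʳ (suc (suc (n ℕ.+ i)))))
  (S₂-> n i)

S₂-n-n : ∀ n → S₂ n n ≡ 1
S₂-n-n zero    = refl
S₂-n-n (suc n) = cong₂ ℕ._+_
  (trans (cong (suc n ℕ.*_) (trans (cong (λ k → S₂ n (suc k)) (sym (ℕ.+-identityʳ n))) (S₂-> n 0))) (ℕ.*-zeroʳ (suc n)))
  (S₂-n-n n)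

-- Both sides obey the same recurrence, by `Q^-rec`. The induction is lexicographic: the Stirling
-- recurrence at (l, d + 1) refers to (l, d) and (l - 1, d + 1), and d = 0 is the diagonal, where
-- the Stirling number and the constant term of the power are both 1.
S₂-closed-form : ∀ l d → fromℕ (S₂ (suc (l ℕ.+ d)) (suc l)) * fromℕ (l !) ≡
                  fromℕ ((l ℕ.+ d) !) * (Q ^ suc (l ℕ.+ d)) d
S₂-closed-form l zero = begin
  fromℕ (S₂ (suc (l ℕ.+ 0)) (suc l)) * fromℕ (l !)
    ≡⟨ cong (λ k → fromℕ (S₂ (suc k) (suc l)) * fromℕ (l !)) (ℕ.+-identityʳ l) ⟩
  fromℕ (S₂ (suc l) (suc l)) * fromℕ (l !)
    ≡⟨ cong (λ x → fromℕ x * fromℕ (l !)) (S₂-n-n (suc l)) ⟩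
  1ℚ * fromℕ (l !)
    ≡⟨ ℚ.*-comm 1ℚ (fromℕ (l !)) ⟩
  fromℕ (l !) * 1ℚ
    ≡⟨ cong₂ (λ k x → fromℕ (k !) * x) (ℕ.+-identityʳ l) (Q^-zero (suc (l ℕ.+ 0))) ⟨
  fromℕ ((l ℕ.+ 0) !) * (Q ^ suc (l ℕ.+ 0)) 0 ∎
  where open ≡-Reasoning
S₂-closed-form l (suc d) = begin
  fromℕ (S₂ (suc (l ℕ.+ suc d)) (suc l)) * fromℕ (l !)
    ≡⟨ cong (λ k → fromℕ (S₂ (suc k) (suc l)) * fromℕ (l !)) (ℕ.+-suc l d) ⟩
  fromℕ (suc l ℕ.* S₂ (suc m) (suc l) ℕ.+ S₂ (suc m) l) * fromℕ (l !)
    ≡⟨ cong (_* fromℕ (l !)) (trans (fromℕ-+ (suc l ℕ.* S₂ (suc m) (suc l)) (S₂ (suc m) l))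
         (cong (_+ fromℕ (S₂ (suc m) l)) (fromℕ-* (suc l) (S₂ (suc m) (suc l))))) ⟩
  (fromℕ (suc l) * fromℕ (S₂ (suc m) (suc l)) + fromℕ (S₂ (suc m) l)) * fromℕ (l !)
    ≡⟨ solve 4 (λ a b c d → (a :* b :+ c) :* d := a :* (b :* d) :+ c :* d) refl
         (fromℕ (suc l)) (fromℕ (S₂ (suc m) (suc l))) (fromℕ (S₂ (suc m) l)) (fromℕ (l !)) ⟩
  fromℕ (suc l) * (fromℕ (S₂ (suc m) (suc l)) * fromℕ (l !)) + fromℕ (S₂ (suc m) l) * fromℕ (l !)
    ≡⟨ cong₂ (λ x y → fromℕ (suc l) * x + y) (S₂-closed-form l d) (below l) ⟩
  fromℕ (suc l) * (fromℕ (m !) * (Q ^ suc m) d) + fromℕ l * (fromℕ (m !) * (Q ^ suc m) (suc d))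
    ≡⟨ solve 5 (λ a b f x y → a :* (f :* x) :+ b :* (f :* y) := f :* (a :* x :+ b :* y)) refl
         (fromℕ (suc l)) (fromℕ l) (fromℕ (m !)) ((Q ^ suc m) d) ((Q ^ suc m) (suc d)) ⟩
  fromℕ (m !) * (fromℕ (suc l) * (Q ^ suc m) d + fromℕ l * (Q ^ suc m) (suc d))
    ≡⟨ cong (fromℕ (m !) *_) (Q^-rec l d) ⟨
  fromℕ (m !) * (fromℕ (suc m) * (Q ^ suc (suc m)) (suc d))
    ≡⟨ solve 3 (λ a b c → a :* (b :* c) := (b :* a) :* c) refl (fromℕ (m !)) (fromℕ (suc m)) ((Q ^ suc (suc m)) (suc d)) ⟩
  fromℕ (suc m) * fromℕ (m !) * (Q ^ suc (suc m)) (suc d)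
    ≡⟨ cong (_* (Q ^ suc (suc m)) (suc d)) (fromℕ-* (suc m) (m !)) ⟨
  fromℕ (suc m !) * (Q ^ suc (suc m)) (suc d)
    ≡⟨ cong (λ k → fromℕ (k !) * (Q ^ suc k) (suc d)) (ℕ.+-suc l d) ⟨
  fromℕ ((l ℕ.+ suc d) !) * (Q ^ suc (l ℕ.+ suc d)) (suc d) ∎
  where
  open ≡-Reasoning
  m = l ℕ.+ d
  below : ∀ l → fromℕ (S₂ (suc (l ℕ.+ d)) l) * fromℕ (l !) ≡
          fromℕ l * (fromℕ ((l ℕ.+ d) !) * (Q ^ suc (l ℕ.+ d)) (suc d))
  -- At the edge l = 0 there is no smaller index to refer to, but the Stirling number and the weight
  -- `l` both vanish.
  below zero    = sym (ℚ.*-zeroˡ (fromℕ (d !) * (Q ^ suc d) (suc d)))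
  below (suc l) = begin
    fromℕ (S₂ (suc (suc l ℕ.+ d)) (suc l)) * fromℕ (suc l !)
      ≡⟨ cong (fromℕ (S₂ (suc (suc l ℕ.+ d)) (suc l)) *_) (fromℕ-* (suc l) (l !)) ⟩
    fromℕ (S₂ (suc (suc l ℕ.+ d)) (suc l)) * (fromℕ (suc l) * fromℕ (l !))
      ≡⟨ solve 3 (λ a b c → a :* (b :* c) := b :* (a :* c)) refl (fromℕ (S₂ (suc (suc l ℕ.+ d)) (suc l))) (fromℕ (suc l)) (fromℕ (l !)) ⟩
    fromℕ (suc l) * (fromℕ (S₂ (suc (suc l ℕ.+ d)) (suc l)) * fromℕ (l !))
      ≡⟨ cong (fromℕ (suc l) *_) (trans
           (cong (λ k → fromℕ (S₂ (suc k) (suc l)) * fromℕ (l !)) (sym (ℕ.+-suc l d)))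
           (trans (S₂-closed-form l (suc d)) (cong (λ k → fromℕ (k !) * (Q ^ suc k) (suc d)) (ℕ.+-suc l d)))) ⟩
    fromℕ (suc l) * (fromℕ ((suc l ℕ.+ d) !) * (Q ^ suc (suc l ℕ.+ d)) (suc d)) ∎

-- Binomial coefficients and sums over tuples

nCk*k!*[n∸k]! : ∀ {n k} → k ≤ n → (n C k) ℕ.* (k ! ℕ.* (n ∸ k) !) ≡ n !
nCk*k!*[n∸k]! {n} {k} k≤n = trans
  (cong (ℕ._* (k ! ℕ.* (n ∸ k) !)) (nCk≡n!/k![n-k]! k≤n))
  (m/n*n≡m (k![n∸k]!∣n! k≤n))
  where instance _ = k ℕ.!* (n ∸ k) !≢0

-- Multiplied by (n - m)!, both sides become n! (n + 1)!. In fractions: C(n, m) (n + 1)! / (m + 1)!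
-- = (n! / m!) C(n + 1, m + 1).
C-absorption : ∀ {n m} → m ≤ n →
  (n C m) ℕ.* m ! ℕ.* suc n ! ≡ n ! ℕ.* (suc n C suc m) ℕ.* suc m !
C-absorption {n} {m} m≤n = ℕ.*-cancelʳ-≡ _ _ ((n ∸ m) !) {{(n ∸ m) ℕ.!≢0}} (begin
  (n C m) ℕ.* m ! ℕ.* suc n ! ℕ.* r       ≡⟨ shuffle (n C m) (m !) (suc n !) r ⟩
  (n C m) ℕ.* (m ! ℕ.* r) ℕ.* suc n !     ≡⟨ cong (ℕ._* suc n !) (nCk*k!*[n∸k]! m≤n) ⟩
  n ! ℕ.* suc n !                         ≡⟨ cong (n ! ℕ.*_) (nCk*k!*[n∸k]! (s≤s m≤n)) ⟨
  n ! ℕ.* ((suc n C suc m) ℕ.* (suc m ! ℕ.* r)) ≡⟨ shuffle′ (n !) (suc n C suc m) (suc m !) r ⟩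
  n ! ℕ.* (suc n C suc m) ℕ.* suc m ! ℕ.* r ∎)
  where
  open ≡-Reasoning
  r = (n ∸ m) !
  shuffle : ∀ a b c d → a ℕ.* b ℕ.* c ℕ.* d ≡ a ℕ.* (b ℕ.* d) ℕ.* c
  shuffle = solve-∀
  shuffle′ : ∀ a b c d → a ℕ.* (b ℕ.* (c ℕ.* d)) ≡ a ℕ.* b ℕ.* c ℕ.* d
  shuffle′ = solve-∀

-- Multiplication by 1 + t acts on coefficients as Pascal's rule.
[1+𝕥]^ : ∀ n k → (1+𝕥 ^ n) k ≡ fromℕ (n C k)
[1+𝕥]^ zero    zero    = refl
[1+𝕥]^ zero    (suc k) = cong fromℕ (sym (k>n⇒nCk≡0 {0} {suc k} (s≤s z≤n)))
[1+𝕥]^ (suc n) zero    = trans ([1+𝕥]⊛-zero (1+𝕥 ^ n)) ([1+𝕥]^ n zero)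
[1+𝕥]^ (suc n) (suc k) = begin
  (1+𝕥 ⊛ 1+𝕥 ^ n) (suc k)             ≡⟨ [1+𝕥]⊛-suc (1+𝕥 ^ n) k ⟩
  (1+𝕥 ^ n) (suc k) + (1+𝕥 ^ n) k     ≡⟨ cong₂ _+_ ([1+𝕥]^ n (suc k)) ([1+𝕥]^ n k) ⟩
  fromℕ (n C suc k) + fromℕ (n C k)   ≡⟨ ℚ.+-comm (fromℕ (n C suc k)) (fromℕ (n C k)) ⟩
  fromℕ (n C k) + fromℕ (n C suc k)   ≡⟨ fromℕ-+ (n C k) (n C suc k) ⟨
  fromℕ (n C k ℕ.+ n C suc k)         ≡⟨ cong fromℕ (nCk+nC[k+1]≡[n+1]C[k+1] n k) ⟩
  fromℕ (suc n C suc k)               ∎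
  where open ≡-Reasoning

-- The factors are exchanged on the right so that, for `Q`, the summation index of the convolution
-- is the degree taken from the power of `G`; it becomes m - l in the theorem.
^-distrib-⊛ : ∀ f g n → (f ⊛ g) ^ n ≗ g ^ n ⊛ f ^ n
^-distrib-⊛ f g zero    = 𝕊.sym (𝕊.trans (𝕊.*-congʳ {𝟙} 𝟙≗κ1) (⊛-identityˡ 𝟙))
^-distrib-⊛ f g (suc n) = 𝕊.trans (𝕊.*-congˡ {f ⊛ g} (^-distrib-⊛ f g n))
  (solveₛ 4 (λ f g p q → (f :⊛ g) :⊛ (q :⊛ p) :≗ (g :⊛ q) :⊛ (f :⊛ p)) 𝕊.refl f g (f ^ n) (g ^ n))

[Q^n]ᵈ : ∀ n d → (Q ^ n) d ≡ ∑[ j ≤ d ] ((G ^ n) (toℕ j) * fromℕ (n C (d ∸ toℕ j)))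
[Q^n]ᵈ n d = trans (^-distrib-⊛ 1+𝕥 G n d)
  (sum-cong-≗ {suc d} λ j → cong ((G ^ n) (toℕ j) *_) ([1+𝕥]^ n (d ∸ toℕ j)))

-- Sums over tuples as coefficients of powers

module _ {a} {A : Set a} where

  sumOver-cong : ∀ (xs : List A) {f g : A → ℚ} → f ≗ g → sumOver xs f ≡ sumOver xs g
  sumOver-cong xs f≗g = cong (List.foldr _+_ 0ℚ) (List.map-cong f≗g xs)

  sumOver-++ : ∀ (xs ys : List A) f → sumOver (xs ++ ys) f ≡ sumOver xs f + sumOver ys f
  sumOver-++ []       ys f = sym (ℚ.+-identityˡ (sumOver ys f))
  sumOver-++ (x ∷ xs) ys f = trans (cong (f x +_) (sumOver-++ xs ys f))
    (sym (ℚ.+-assoc (f x) (sumOver xs f) (sumOver ys f)))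

  sumOver-*ˡ : ∀ (xs : List A) c f → sumOver xs (λ x → c * f x) ≡ c * sumOver xs f
  sumOver-*ˡ []       c f = sym (ℚ.*-zeroʳ c)
  sumOver-*ˡ (x ∷ xs) c f = trans (cong (c * f x +_) (sumOver-*ˡ xs c f))
    (sym (ℚ.*-distribˡ-+ c (f x) (sumOver xs f)))

  sumOver-applyUpTo : ∀ (g : ℕ → A) n f → sumOver (applyUpTo g n) f ≡ ∑[ i < n ] f (g (toℕ i))
  sumOver-applyUpTo g zero    f = refl
  sumOver-applyUpTo g (suc n) f = cong (f (g 0) +_) (sumOver-applyUpTo (g ∘ suc) n f)

  sumOver-map : ∀ {b} {B : Set b} (g : B → A) xs f → sumOver (List.map g xs) f ≡ sumOver xs (f ∘ g)
  sumOver-map g xs f = cong (List.foldr _+_ 0ℚ) (sym (List.map-∘ xs))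

  sumOver-concatMap : ∀ {b} {B : Set b} (g : B → List A) xs f →
                      sumOver (concatMap g xs) f ≡ ∑[ x ∈ xs ] sumOver (g x) f
  sumOver-concatMap g []       f = refl
  sumOver-concatMap g (x ∷ xs) f = trans (sumOver-++ (g x) (concatMap g xs) f)
    (cong (sumOver (g x) f +_) (sumOver-concatMap g xs f))

-- The first entry of a tuple plays the role of the convolution index in f ⊛ fⁿ.
sumOver-tuples : ∀ (f : Series) n s → ∑[ v ∈ tuples n s ] ∏ (map f v) ≡ (f ^ n) s
sumOver-tuples f zero    zero    = refl
sumOver-tuples f zero    (suc s) = refl
sumOver-tuples f (suc n) s = begin
  ∑[ v ∈ tuples (suc n) s ] ∏ (map f v)
    ≡⟨ sumOver-concatMap (λ i → List.map (i ∷_) (tuples n (s ∸ i))) (upTo (suc s)) (λ v → ∏ (map f v)) ⟩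
  ∑[ i ∈ upTo (suc s) ] ∑[ v ∈ List.map (i ∷_) (tuples n (s ∸ i)) ] ∏ (map f v)
    ≡⟨ sumOver-cong (upTo (suc s)) term ⟩
  ∑[ i ∈ upTo (suc s) ] (f i * (f ^ n) (s ∸ i))
    ≡⟨ sumOver-applyUpTo (λ i → i) (suc s) (λ i → f i * (f ^ n) (s ∸ i)) ⟩
  (f ^ suc n) s ∎
  where
  open ≡-Reasoning
  term : ∀ i → ∑[ v ∈ List.map (i ∷_) (tuples n (s ∸ i)) ] ∏ (map f v) ≡ f i * (f ^ n) (s ∸ i)
  term i = begin
    ∑[ v ∈ List.map (i ∷_) (tuples n (s ∸ i)) ] ∏ (map f v) ≡⟨ sumOver-map (i ∷_) (tuples n (s ∸ i)) (λ v → ∏ (map f v)) ⟩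
    ∑[ v ∈ tuples n (s ∸ i) ] (f i * ∏ (map f v))           ≡⟨ sumOver-*ˡ (tuples n (s ∸ i)) (f i) (λ v → ∏ (map f v)) ⟩
    f i * (∑[ v ∈ tuples n (s ∸ i) ] ∏ (map f v))           ≡⟨ cong (f i *_) (sumOver-tuples f n (s ∸ i)) ⟩
    f i * (f ^ n) (s ∸ i)                                   ∎

∏-bernoulli : ∀ {n} (v : Vec ℕ n) → ∏ (map (λ k → bernoulli k k) v) ≡
  fromℕ (product (List.map _! (Vec.toList v))) * ∏ (map G v)
∏-bernoulli []      = refl
∏-bernoulli (k ∷ v) = begin
  fromℕ (k !) * G k * ∏ (map (λ k → bernoulli k k) v)
    ≡⟨ cong (fromℕ (k !) * G k *_) (∏-bernoulli v) ⟩
  fromℕ (k !) * G k * (fromℕ p * ∏ (map G v))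
    ≡⟨ solve 4 (λ a b c d → a :* b :* (c :* d) := (a :* c) :* (b :* d)) refl (fromℕ (k !)) (G k) (fromℕ p) (∏ (map G v)) ⟩
  fromℕ (k !) * fromℕ p * (G k * ∏ (map G v))
    ≡⟨ cong (_* (G k * ∏ (map G v))) (fromℕ-* (k !) p) ⟨
  fromℕ (k ! ℕ.* p) * (G k * ∏ (map G v)) ∎
  where
  open ≡-Reasoning
  p = product (List.map _! (Vec.toList v))

-- The factorials in B_k^(k) = k! G k are exactly the denominator of the multinomial coefficient.
multinomial*∏ : ∀ {n} N (v : Vec ℕ n) →
  multinomial N v * ∏ (map (λ k → bernoulli k k) v) ≡ fromℕ (N !) * ∏ (map G v)
multinomial*∏ N v = begin
  multinomial N v * ∏ (map (λ k → bernoulli k k) v)  ≡⟨ cong (multinomial N v *_) (∏-bernoulli v) ⟩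
  multinomial N v * (fromℕ p * ∏ (map G v))          ≡⟨ ℚ.*-assoc (multinomial N v) (fromℕ p) (∏ (map G v)) ⟨
  multinomial N v * fromℕ p * ∏ (map G v)            ≡⟨ cong (_* ∏ (map G v)) (/-*-fromℕ (N !) p {{p≢0}}) ⟩
  fromℕ (N !) * ∏ (map G v)                          ∎
  where
  open ≡-Reasoning
  p = product (List.map _! (Vec.toList v))
  p≢0 : NonZero p
  p≢0 = product≢0 (All.map⁺ (All.universal ℕ._!≢0 (Vec.toList v)))

sumOver-multinomial : ∀ n s c →
  ∑[ v ∈ tuples n s ] (c * multinomial s v * ∏ (map (λ k → bernoulli k k) v)) ≡
  c * fromℕ (s !) * (G ^ n) s
sumOver-multinomial n s c = begin
  ∑[ v ∈ tuples n s ] (c * multinomial s v * ∏ (map (λ k → bernoulli k k) v))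
    ≡⟨ sumOver-cong (tuples n s) term ⟩
  ∑[ v ∈ tuples n s ] (c * fromℕ (s !) * ∏ (map G v))
    ≡⟨ sumOver-*ˡ (tuples n s) (c * fromℕ (s !)) (λ v → ∏ (map G v)) ⟩
  c * fromℕ (s !) * (∑[ v ∈ tuples n s ] ∏ (map G v))
    ≡⟨ cong (c * fromℕ (s !) *_) (sumOver-tuples G n s) ⟩
  c * fromℕ (s !) * (G ^ n) s ∎
  where
  open ≡-Reasoning
  term : ∀ v → c * multinomial s v * ∏ (map (λ k → bernoulli k k) v) ≡ c * fromℕ (s !) * ∏ (map G v)
  term v = trans (ℚ.*-assoc c (multinomial s v) _)
    (trans (cong (c *_) (multinomial*∏ s v)) (sym (ℚ.*-assoc c (fromℕ (s !)) (∏ (map G v)))))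

-- Here l, l + j and l + d stand for l - 1, m - 1 and n - 1 of the theorem. The factors l! j! turn
-- the second binomial coefficient into (l + j)!; then `C-absorption` applies, and the symmetry of
-- binomial coefficients gives the lower index d - j.
coefficient-identity : ∀ l {d j} → j ≤ d →
  fromℕ ((l ℕ.+ d) C (l ℕ.+ j)) * fromℕ ((l ℕ.+ j) C l) * (suc (l ℕ.+ d) !/ suc (l ℕ.+ j) !)
    * fromℕ (j !) * fromℕ (l !)
  ≡ fromℕ ((l ℕ.+ d) !) * fromℕ (suc (l ℕ.+ d) C (d ∸ j))
coefficient-identity l {d} {j} j≤d = *-cancelʳ-fromℕ (suc m !) {{suc m ℕ.!≢0}} (begin
  a * b * q * fromℕ (j !) * fromℕ (l !) * fromℕ (suc m !)
    ≡⟨ solve 6 (λ a b q j l m → a :* b :* q :* j :* l :* m := a :* (b :* (l :* j)) :* (q :* m)) refl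
         a b q (fromℕ (j !)) (fromℕ (l !)) (fromℕ (suc m !)) ⟩
  a * (b * (fromℕ (l !) * fromℕ (j !))) * (q * fromℕ (suc m !))
    ≡⟨ cong₂ (λ x y → a * x * y) b*l!*j! (/-*-fromℕ (suc n !) (suc m !) {{suc m ℕ.!≢0}}) ⟩
  a * fromℕ (m !) * fromℕ (suc n !)
    ≡⟨ fromℕ-*₃ (n C m) (m !) (suc n !) ⟨
  fromℕ ((n C m) ℕ.* m ! ℕ.* suc n !)
    ≡⟨ cong fromℕ (C-absorption m≤n) ⟩
  fromℕ (n ! ℕ.* (suc n C suc m) ℕ.* suc m !)
    ≡⟨ fromℕ-*₃ (n !) (suc n C suc m) (suc m !) ⟩
  fromℕ (n !) * fromℕ (suc n C suc m) * fromℕ (suc m !)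
    ≡⟨ cong (λ x → fromℕ (n !) * fromℕ x * fromℕ (suc m !))
         (trans (nCk≡nC[n∸k] (s≤s m≤n)) (cong (suc n C_) (ℕ.[m+n]∸[m+o]≡n∸o l d j))) ⟩
  fromℕ (n !) * fromℕ (suc n C (d ∸ j)) * fromℕ (suc m !) ∎)
  where
  open ≡-Reasoning
  n = l ℕ.+ d
  m = l ℕ.+ j
  a = fromℕ (n C m)
  b = fromℕ (m C l)
  q = suc n !/ suc m !

  m≤n : m ≤ n
  m≤n = ℕ.+-monoʳ-≤ l j≤d

  fromℕ-*₃ : ∀ x y z → fromℕ (x ℕ.* y ℕ.* z) ≡ fromℕ x * fromℕ y * fromℕ z
  fromℕ-*₃ x y z = trans (fromℕ-* (x ℕ.* y) z) (cong (_* fromℕ z) (fromℕ-* x y))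

  b*l!*j! : b * (fromℕ (l !) * fromℕ (j !)) ≡ fromℕ (m !)
  b*l!*j! = begin
    b * (fromℕ (l !) * fromℕ (j !)) ≡⟨ cong (b *_) (fromℕ-* (l !) (j !)) ⟨
    b * fromℕ (l ! ℕ.* j !)         ≡⟨ fromℕ-* (m C l) (l ! ℕ.* j !) ⟨
    fromℕ ((m C l) ℕ.* (l ! ℕ.* j !)) ≡⟨ cong (λ k → fromℕ ((m C l) ℕ.* (l ! ℕ.* k !))) (ℕ.m+n∸m≡n l j) ⟨
    fromℕ ((m C l) ℕ.* (l ! ℕ.* (m ∸ l) !)) ≡⟨ cong fromℕ (nCk*k!*[n∸k]! (ℕ.m≤m+n l j)) ⟩
    fromℕ (m !) ∎

theorem8 : (n l : ℕ) → 1 ≤ n → 1 ≤ l → l ≤ n →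
    fromℕ (S₂ n l) ≡
    ∑[ m ∈ l ⋯ n ] ∑[ ls ∈ tuples n (m ∸ l) ]
    (fromℕ ((n ∸ 1) C (m ∸ 1)) * fromℕ ((m ∸ 1) C (l ∸ 1)) * (n !/ m !)
    * multinomial (m ∸ l) ls * ∏ (map (λ k → bernoulli k k) ls))
-- From here `n` and `l` are one less than in the statement, with `d` their difference. Both sides
-- are multiplied by `l !` to match `S₂-closed-form`, and the outer index is m = l + 1 + j with j at
-- most d.
theorem8 (suc n) (suc l) _ _ (s≤s l≤n) with d , refl ← ℕ.m≤n⇒∃[o]m+o≡n l≤n =
  *-cancelʳ-fromℕ (l !) {{l ℕ.!≢0}} (begin
    fromℕ (S₂ (suc n) (suc l)) * fromℕ (l !)
      ≡⟨ S₂-closed-form l d ⟩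
    fromℕ (n !) * (Q ^ suc n) d
      ≡⟨ cong (fromℕ (n !) *_) ([Q^n]ᵈ (suc n) d) ⟩
    fromℕ (n !) * (∑[ j ≤ d ] ((G ^ suc n) (toℕ j) * fromℕ (suc n C (d ∸ toℕ j))))
      ≡⟨ *-distribˡ-sum {suc d} (fromℕ (n !)) (λ j → (G ^ suc n) (toℕ j) * fromℕ (suc n C (d ∸ toℕ j))) ⟩
    ∑[ j ≤ d ] (fromℕ (n !) * ((G ^ suc n) (toℕ j) * fromℕ (suc n C (d ∸ toℕ j))))
      ≡⟨ sum-cong-≗ {suc d} (λ j → term (toℕ j) (Fin.toℕ≤pred[n] j)) ⟩
    ∑[ j ≤ d ] (inner (suc l ℕ.+ toℕ j) * fromℕ (l !))
      ≡⟨ *-distribʳ-sum {suc d} (fromℕ (l !)) (λ j → inner (suc l ℕ.+ toℕ j)) ⟨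
    (∑[ j ≤ d ] inner (suc l ℕ.+ toℕ j)) * fromℕ (l !)
      ≡⟨ cong (_* fromℕ (l !)) (sumOver-applyUpTo (suc l ℕ.+_) (suc d) inner) ⟨
    sumOver (applyUpTo (suc l ℕ.+_) (suc d)) inner * fromℕ (l !)
      -- The range from l + 1 to n + 1 has d + 1 elements.
      ≡⟨ cong (λ k → sumOver (applyUpTo (suc l ℕ.+_) k) inner * fromℕ (l !))
           (trans (cong (_∸ l) (sym (ℕ.+-suc l d))) (ℕ.m+n∸m≡n l (suc d))) ⟨
    sumOver (suc l ⋯ suc n) inner * fromℕ (l !) ∎)
  where
  open ≡-Reasoning

  c : ℕ → ℚ
  c m = fromℕ (n C (m ∸ 1)) * fromℕ ((m ∸ 1) C l) * (suc n !/ m !)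

  inner : ℕ → ℚ
  inner m = ∑[ ls ∈ tuples (suc n) (m ∸ suc l) ]
    (c m * multinomial (m ∸ suc l) ls * ∏ (map (λ k → bernoulli k k) ls))

  term : ∀ j → j ≤ d →
         fromℕ (n !) * ((G ^ suc n) j * fromℕ (suc n C (d ∸ j))) ≡ inner (suc l ℕ.+ j) * fromℕ (l !)
  term j j≤d = begin
    fromℕ (n !) * (g * fromℕ (suc n C (d ∸ j)))
      ≡⟨ solve 3 (λ a b c → a :* (b :* c) := (a :* c) :* b) refl (fromℕ (n !)) g (fromℕ (suc n C (d ∸ j))) ⟩
    fromℕ (n !) * fromℕ (suc n C (d ∸ j)) * g
      ≡⟨ cong (_* g) (coefficient-identity l j≤d) ⟨
    c m * fromℕ (j !) * fromℕ (l !) * g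
      ≡⟨ solve 4 (λ a b c d → a :* b :* c :* d := a :* b :* d :* c) refl (c m) (fromℕ (j !)) (fromℕ (l !)) g ⟩
    c m * fromℕ (j !) * g * fromℕ (l !)
      ≡⟨ cong (λ s → c m * fromℕ (s !) * (G ^ suc n) s * fromℕ (l !)) (ℕ.m+n∸m≡n l j) ⟨
    c m * fromℕ ((m ∸ suc l) !) * (G ^ suc n) (m ∸ suc l) * fromℕ (l !)
      ≡⟨ cong (_* fromℕ (l !)) (sumOver-multinomial (suc n) (m ∸ suc l) (c m)) ⟨
    inner m * fromℕ (l !) ∎
    where
    m = suc l ℕ.+ j
    g = (G ^ suc n) j
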